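{- Let $n \geqslant r \geqslant 3$ and $k \geqslant 2$ be integers, and let $H$ be the balanced complete $k$-partite $r$-uniform hypergraph with $n$ vertices in each class. The following $2$-coloring (colors red and blue) of the vertices of $H$ minimizes the number of monochromatic edges of $H$ among all $2$-colorings: (1) color all vertices of the first $\lfloor k/2\rfloor$ classes red; (2) color all vertices of the last $\lfloor k/2\rfloor$ classes blue; (3) if there is another class (i.e. $k$ is odd), color the vertices of that class so that the numbers of red and blue vertices in it are as equal as possible (i.e. they differ by at most $1$). Moreover, this minimizing coloring is unique up to a permutation of colors and classes.
   Context: The balanced complete $k$-partite $r$-uniform hypergraph with $n$ vertices in each class has vertex set the disjoint union of $k$ classes $V_1,\dots,V_k$ with $|V_i|=n$, and its edges are all $r$-element subsets of $V_1\cup\dots\cup V_k$ that are not contained in a single class $V_i$ (an edge may contain several vertices of the same class). A $2$-coloring assigns to each vertex one of two colors (not required to be proper). An edge is monochromatic if all its vertices have the same color. Colorings having the same number of vertices of each color in each class are regarded as the same coloring; "unique up to a permutation of colors and classes" means that every minimizing coloring is obtained from the described one by permuting the names of the colors and permuting the classes. -}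

module Defs where

open import Data.Fin.Base using (Fin; quotient; toℕ)
open import Data.Fin.Permutation using (Permutation′; _⟨$⟩ʳ_)
open import Data.Fin.Properties using (_≟_; any?; all?)
open import Data.Fin.Subset using (Subset; inside; outside; _∈_; ∣_∣)
open import Data.Fin.Subset.Properties using (_∈?_)
open import Data.List.Base using (List; []; _∷_; _++_; map; filter; length; allFin)
import Data.List.Membership.Propositional as List
open import Data.List.Membership.Propositional.Properties using (∈-++⁺ˡ; ∈-++⁺ʳ; ∈-map⁺; ∈-map⁻)
open import Data.List.Relation.Unary.Any using (here)
import Data.List.Relation.Unary.All as All
import Data.List.Relation.Unary.AllPairs as AllPairs
open import Data.List.Relation.Unary.Unique.Propositional using (Unique)
import Data.List.Relation.Unary.Unique.Propositional.Properties as Unique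
open import Data.Nat.Base using (ℕ; zero; suc; _*_; _∸_; _≤_; _<_; ⌊_/2⌋; ∣_-_∣)
import Data.Nat.Properties as ℕ
open import Data.Product.Base using (∃-syntax; Σ-syntax; _×_; _,_)
open import Data.Vec.Base using ([]; _∷_)
open import Data.Vec.Properties using (∷-injectiveʳ)
open import Function.Bundles using (_↔_; Inverse)
open import Relation.Binary.Definitions using (DecidableEquality)
open import Relation.Binary.PropositionalEquality using (_≡_; refl)
open import Relation.Nullary.Decidable using (yes; no; ¬?; _×-dec_; _→-dec_)
open import Relation.Nullary.Negation using (¬_)
open import Relation.Unary using (Decidable)

allSubsets : ∀ N → List (Subset N)
allSubsets zero    = [] ∷ []
allSubsets (suc N) = map (outside ∷_) (allSubsets N) ++ map (inside ∷_) (allSubsets N)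

∈-allSubsets : ∀ {N} (s : Subset N) → s List.∈ allSubsets N
∈-allSubsets []            = here refl
∈-allSubsets (outside ∷ s) = ∈-++⁺ˡ (∈-map⁺ (outside ∷_) (∈-allSubsets s))
∈-allSubsets (inside  ∷ s) =
  ∈-++⁺ʳ (map (outside ∷_) (allSubsets _)) (∈-map⁺ (inside ∷_) (∈-allSubsets s))

allSubsets-unique : ∀ N → Unique (allSubsets N)
allSubsets-unique zero    = All.[] AllPairs.∷ AllPairs.[]
allSubsets-unique (suc N) =
  Unique.++⁺ (Unique.map⁺ ∷-injectiveʳ (allSubsets-unique N))
             (Unique.map⁺ ∷-injectiveʳ (allSubsets-unique N))
             λ { (p , q) → disjoint (∈-map⁻ (outside ∷_) p) (∈-map⁻ (inside ∷_) q) }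
  where
  disjoint : ∀ {s} → ∃[ t ] (t List.∈ allSubsets N × s ≡ outside ∷ t) →
             ¬ (∃[ t ] (t List.∈ allSubsets N × s ≡ inside ∷ t))
  disjoint (_ , _ , refl) (_ , _ , ())

record Hypergraph : Set₁ where
  field
    order   : ℕ
    IsEdge  : Subset order → Set
    isEdge? : Decidable IsEdge

data Color : Set where
  red blue : Color

_≟ᶜ_ : DecidableEquality Color
red  ≟ᶜ red  = yes refl
red  ≟ᶜ blue = no λ ()
blue ≟ᶜ red  = no λ ()
blue ≟ᶜ blue = yes refl

module _ (H : Hypergraph) where
  open Hypergraph H

  Coloring : Set
  Coloring = Fin order → Color

  HasColor : Coloring → Color → Subset order → Set
  HasColor χ c e = ∀ v → v ∈ e → χ v ≡ c

  hasColor? : ∀ χ c → Decidable (HasColor χ c)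
  hasColor? χ c e = all? λ v → (v ∈? e) →-dec (χ v ≟ᶜ c)

  IsMonochromatic : Coloring → Subset order → Set
  IsMonochromatic χ e = ∃[ c ] HasColor χ c e

  isMonochromatic? : ∀ χ → Decidable (IsMonochromatic χ)
  isMonochromatic? χ e with hasColor? χ red e | hasColor? χ blue e
  ... | yes p | _     = yes (red , p)
  ... | no _  | yes q = yes (blue , q)
  ... | no ¬p | no ¬q = no λ { (red , p) → ¬p p ; (blue , q) → ¬q q }

  #monochromatic : Coloring → ℕ
  #monochromatic χ =
    length (filter (λ e → isEdge? e ×-dec isMonochromatic? χ e) (allSubsets order))

  IsMinimizing : Coloring → Set
  IsMinimizing χ = ∀ χ′ → #monochromatic χ ≤ #monochromatic χ′

module _ (k n : ℕ) where

  -- The disjoint union of k classes of n vertices, as consecutive blocks.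
  Vertex : Set
  Vertex = Fin (k * n)

  class : Vertex → Fin k
  class = quotient n

  InSingleClass : Subset (k * n) → Set
  InSingleClass e = ∃[ i ] (∀ v → v ∈ e → class v ≡ i)

  inSingleClass? : Decidable InSingleClass
  inSingleClass? e = any? λ i → all? λ v → (v ∈? e) →-dec (class v ≟ i)

  completePartite : ℕ → Hypergraph
  completePartite r = record
    { order   = k * n
    ; IsEdge  = λ e → ∣ e ∣ ≡ r × ¬ InSingleClass e
    ; isEdge? = λ e → (∣ e ∣ ℕ.≟ r) ×-dec ¬? (inSingleClass? e)
    }

  #colored : (Vertex → Color) → Fin k → Color → ℕ
  #colored χ i c =
    length (filter (λ v → (class v ≟ i) ×-dec (χ v ≟ᶜ c)) (allFin (k * n)))

  -- The classes outside the first and the last ⌊k/2⌋ consist of the single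
  -- middle class when k is odd, and there are none when k is even.
  record IsHalfSplit (χ : Vertex → Color) : Set where
    field
      first  : ∀ v → toℕ (class v) < ⌊ k /2⌋ → χ v ≡ red
      last   : ∀ v → k ∸ ⌊ k /2⌋ ≤ toℕ (class v) → χ v ≡ blue
      middle : ∀ i → ⌊ k /2⌋ ≤ toℕ i → toℕ i < k ∸ ⌊ k /2⌋ →
               ∣ #colored χ i red - #colored χ i blue ∣ ≤ 1

  -- Colorings are compared through their color counts in each class only.
  SameUpToPermutation : (χ χ′ : Vertex → Color) → Set
  SameUpToPermutation χ χ′ =
    Σ[ σ ∈ Permutation′ k ] Σ[ τ ∈ Color ↔ Color ]
      (∀ i c → #colored χ′ (σ ⟨$⟩ʳ i) (Inverse.to τ c) ≡ #colored χ i c)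

{-# OPTIONS --safe #-}

-- If a class contains s red and t blue vertices, its value is C(s,r) + C(t,r); a coloring with R red
-- and B blue vertices in total has C(R,r) + C(B,r) - (sum of the values) monochromatic edges.
-- Recolor two mixed classes, keeping R and B, so that one of them becomes monochromatic: since C(-,r)
-- is convex, this strictly increases the sum of the values. So a minimizing coloring has at most one
-- mixed class, with s red and t = n - s blue vertices, next to q red and q′ blue classes.
-- For even k the balanced choice R = B minimizes C(R,r) + C(B,r), and no mixed class maximizes the
-- values. For odd k = 2m + 1 and q = q′ = m the count depends on s only through φ(s) + φ(n - s), where
-- φ(x) = C(mn + x,r) - C(x,r) is strictly convex for r ≥ 3, so s and t must be as equal as possible.
-- For q > m both parts of the count are no better than for (m + 1) red and m blue classes, which is
-- the case q = m, s = n already covered, and q < m is symmetric.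
module Submission where

open import Defs
open import Data.Bool.Base using (true; false; if_then_else_)
open import Data.Fin.Base using (Fin; zero; suc; toℕ; cast; remainder; combine; _↑ˡ_; _↑ʳ_)
open import Data.Fin.Permutation using (Permutation′; _⟨$⟩ʳ_; _∘ₚ_; cast-id)
open import Data.Fin.Properties using (remQuot-combine; toℕ-↑ʳ; cast-involutive)
import Data.Fin.Properties as Fin
open import Data.Fin.Subset using (Subset; inside; outside; _∈_; ∣_∣)
open import Data.Fin.Subset.Properties using (_∈?_)
open import Data.List.Base
  using (List; []; _∷_; _++_; map; filter; length; lookup; replicate; tabulate; allFin)
open import Data.List.Properties
  using (map-++; map-∘; map-cong; map-replicate; map-tabulate; length-tabulate; lookup-tabulate)
open import Data.List.Relation.Binary.Permutation.Homogeneous using (onIndices)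
open import Data.List.Relation.Binary.Permutation.Propositional
  using (_↭_; ↭-refl; ↭-sym; ↭-trans; ↭-prep; ↭-swap; ↭-reflexive; ↭⇒↭ₛ)
open import Data.List.Relation.Binary.Permutation.Propositional.Properties
  using (map⁺; shift; ++-comm)
open import Data.List.Relation.Binary.Permutation.Setoid.Properties using (onIndices-lookup)
open import Data.List.Relation.Unary.All using (All; []; _∷_)
open import Data.List.Relation.Unary.All.Properties using (tabulate⁺)
open import Data.Nat.Base
open import Data.Nat.Combinatorics using (_C_; nCk≡nC[n∸k]; nCn≡1; nCk+nC[k+1]≡[n+1]C[k+1])
open import Data.Nat.ListAction using (sum)
open import Data.Nat.ListAction.Properties using (sum-++; sum-↭)
open import Data.Nat.Properties
open import Data.Nat.Tactic.RingSolver using (solve-∀)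
open import Data.Product.Base as Product using (∃-syntax; Σ-syntax; _×_; _,_; proj₁; proj₂)
open import Data.Sum.Base as Sum using (_⊎_; inj₁; inj₂)
open import Data.Vec.Base using ([]; _∷_; here; there)
open import Function.Base using (_∘_)
open import Function.Bundles using (_↔_; mk↔ₛ′)
open import Function.Construct.Identity using (↔-id)
open import Relation.Binary.Definitions using (tri<; tri≈; tri>)
open import Relation.Binary.PropositionalEquality
open import Relation.Nullary.Decidable using (Dec; yes; no; does; _×-dec_; _→-dec_)
open import Relation.Nullary.Negation using (¬_; contradiction)
open import Relation.Unary using (Pred; Decidable)

-- Convexity of binomial coefficients

-- The two hypotheses add up and the common `s + q` cancels. This chains unit steps of convexity.
telescope-≤ : ∀ p q s t u v → p + q ≤ s + t → s + u ≤ v + q → p + u ≤ v + t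
telescope-≤ p q s t u v pq≤st su≤vq = +-cancelʳ-≤ (s + q) _ _
  (subst₂ _≤_ (lemma₁ p q s u) (lemma₂ q s t v) (+-mono-≤ pq≤st su≤vq))
  where
  lemma₁ : ∀ p q s u → (p + q) + (s + u) ≡ (p + u) + (s + q)
  lemma₁ = solve-∀
  lemma₂ : ∀ q s t v → (s + t) + (v + q) ≡ (v + t) + (s + q)
  lemma₂ = solve-∀

telescope-< : ∀ p q s t u v → p + q < s + t → s + u ≤ v + q → p + u < v + t
telescope-< p q s t u v = telescope-≤ (suc p) q s t u v

-- Convexity says that the increment at x is at most the increment at y, written without
-- subtraction.
Monotone StrictlyMonotone Convex : (ℕ → ℕ) → Set
Monotone         f = ∀ {x y} → x ≤ y → f x ≤ f y
StrictlyMonotone f = ∀ {x y} → x < y → f x < f y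
Convex           f = ∀ {x y} → x ≤ y → f (suc x) + f y ≤ f x + f (suc y)

-- C(x, r) is zero for x < r, so strictness can only be expected once the larger point has passed a
-- threshold b.
StrictlyConvexFrom : ℕ → (ℕ → ℕ) → Set
StrictlyConvexFrom b f = ∀ {x y} → x < y → b ≤ y → f (suc x) + f y < f x + f (suc y)

module _ {f h : ℕ → ℕ} (step : ∀ x → f (suc x) ≡ h x + f x) where

  private
    rearrange : ∀ a b c → a + (b + c) ≡ (b + a) + c
    rearrange = solve-∀

  difference-monotone⇒convex : Monotone h → Convex f
  difference-monotone⇒convex h-mono {x} {y} x≤y = begin
    f (suc x) + f y    ≡⟨ cong (_+ f y) (step x) ⟩
    h x + f x + f y    ≤⟨ +-monoˡ-≤ (f y) (+-monoˡ-≤ (f x) (h-mono x≤y)) ⟩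
    h y + f x + f y    ≡⟨ rearrange (f x) (h y) (f y) ⟨
    f x + (h y + f y)  ≡⟨ cong (f x +_) (step y) ⟨
    f x + f (suc y)    ∎
    where open ≤-Reasoning

  difference-increasing⇒strictlyConvex :
    ∀ {b} → (∀ {x y} → x < y → b ≤ y → h x < h y) → StrictlyConvexFrom b f
  difference-increasing⇒strictlyConvex h-mono {x} {y} x<y b≤y = begin-strict
    f (suc x) + f y    ≡⟨ cong (_+ f y) (step x) ⟩
    h x + f x + f y    <⟨ +-monoˡ-< (f y) (+-monoˡ-< (f x) (h-mono x<y b≤y)) ⟩
    h y + f x + f y    ≡⟨ rearrange (f x) (h y) (f y) ⟨
    f x + (h y + f y)  ≡⟨ cong (f x +_) (step y) ⟨
    f x + f (suc y)    ∎
    where open ≤-Reasoning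

strictlyConvex⇒convex : ∀ {f} → StrictlyConvexFrom 0 f → Convex f
strictlyConvex⇒convex {f} strict {x} {y} x≤y with m≤n⇒m<n∨m≡n x≤y
... | inj₁ x<y  = <⇒≤ (strict x<y z≤n)
... | inj₂ refl = ≤-reflexive (+-comm (f (suc x)) (f x))

module _ (f : ℕ → ℕ) (convex : Convex f) where

  -- Both points move by one unit at a time, and the e instances of convexity telescope.
  convex-shift : ∀ {x y} → x ≤ y → ∀ e → f (e + x) + f y ≤ f x + f (e + y)
  convex-shift         x≤y zero    = ≤-refl
  convex-shift {x} {y} x≤y (suc e) =
    telescope-≤ (f (suc e + x)) (f (e + y)) (f (e + x)) (f (suc e + y)) (f y) (f x)
      (convex (+-monoʳ-≤ e x≤y)) (convex-shift x≤y e)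

  module _ {b : ℕ} (strict : StrictlyConvexFrom b f) where

    -- Only the last unit step is taken strictly. It starts at `e + y`, so the threshold has to be
    -- reached only there.
    convex-shift-strict : ∀ {x y} → x < y → ∀ e → b ≤ e + y →
                          f (suc e + x) + f y < f x + f (suc e + y)
    convex-shift-strict {x} {y} x<y e b≤e+y =
      telescope-< (f (suc e + x)) (f (e + y)) (f (e + x)) (f (suc e + y)) (f y) (f x)
        (strict (+-monoʳ-< e x<y) b≤e+y) (convex-shift (<⇒≤ x<y) e)

    private
      -- For a fixed sum the pair is determined by s. If s < s₀, it arises from the balanced pair by
      -- moving both entries apart; if s > s₀, then t ≥ s ≥ t₀ and the sum would be too large.
      balanced-sorted : ∀ {s₀ t₀ s t} → b ≤ t₀ → s₀ ≤ t₀ → t₀ ≤ suc s₀ → s ≤ t →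
                        s + t ≡ s₀ + t₀ →
                        (f s₀ + f t₀ < f s + f t) ⊎ (s ≡ s₀ × t ≡ t₀)
      balanced-sorted {s₀} {t₀} {s} {t} b≤t₀ s₀≤t₀ t₀≤1+s₀ s≤t eq with <-cmp s s₀
      ... | tri≈ _ refl _ = inj₂ (refl , +-cancelˡ-≡ s t t₀ eq)
      ... | tri> _ _ s₀<s = contradiction eq
        (>⇒≢ (+-mono-<-≤ s₀<s (≤-trans t₀≤1+s₀ (≤-trans s₀<s s≤t))))
      -- Here `suc s + e ≡ s₀`: both entries move by e + 1, and the last unit step starts from
      -- `e + t₀`, which is at least b.
      ... | tri< s<s₀ _ _ with m≤n⇒∃[o]m+o≡n s<s₀
      ...   | e , refl = inj₁ (subst₂ (λ x y → f x + f t₀ < f s + f y)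
                           (cong suc (+-comm e s)) (sym t≡)
                           (convex-shift-strict (<-≤-trans s<s₀ s₀≤t₀) e (≤-trans b≤t₀ (m≤n+m t₀ e))))
        where
        lemma : ∀ s e t₀ → suc s + e + t₀ ≡ s + (suc e + t₀)
        lemma = solve-∀
        t≡ : t ≡ suc e + t₀
        t≡ = +-cancelˡ-≡ s _ _ (trans eq (lemma s e t₀))

      close : ∀ {m n} → ∣ m - n ∣ ≤ 1 → n ≤ suc m
      close {m} {n} m-n≤1 = begin
        n              ≤⟨ m≤n+∣m-n∣ n m ⟩
        m + ∣ n - m ∣  ≡⟨ cong (m +_) (∣-∣-comm n m) ⟩
        m + ∣ m - n ∣  ≤⟨ +-monoʳ-≤ m m-n≤1 ⟩
        m + 1          ≡⟨ +-comm m 1 ⟩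
        suc m          ∎
        where open ≤-Reasoning

      balanced-sorted₀ : ∀ {s₀ t₀ s t} → b ≤ t₀ → s₀ ≤ t₀ → ∣ s₀ - t₀ ∣ ≤ 1 →
                         s + t ≡ s₀ + t₀ →
                         (f s₀ + f t₀ < f s + f t) ⊎ (s ≡ s₀ × t ≡ t₀) ⊎ (s ≡ t₀ × t ≡ s₀)
      balanced-sorted₀ {s₀} {t₀} {s} {t} b≤t₀ s₀≤t₀ near eq with ≤-total s t
      ... | inj₁ s≤t = Sum.map₂ inj₁ (balanced-sorted b≤t₀ s₀≤t₀ (close near) s≤t eq)
      ... | inj₂ t≤s = Sum.map (subst (f s₀ + f t₀ <_) (+-comm (f t) (f s)))
                               (λ (p , q) → inj₂ (q , p))
                         (balanced-sorted b≤t₀ s₀≤t₀ (close near) t≤s (trans (+-comm t s) eq))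

    -- Sorting both pairs reduces this to the previous case. It is applied twice: to the color
    -- totals when k is even and to the middle class when k is odd.
    balanced : ∀ {s₀ t₀ s t} → b ≤ s₀ → b ≤ t₀ → ∣ s₀ - t₀ ∣ ≤ 1 → s + t ≡ s₀ + t₀ →
               (f s₀ + f t₀ < f s + f t) ⊎ (s ≡ s₀ × t ≡ t₀) ⊎ (s ≡ t₀ × t ≡ s₀)
    balanced {s₀} {t₀} {s} {t} b≤s₀ b≤t₀ near eq with ≤-total s₀ t₀
    ... | inj₁ s₀≤t₀ = balanced-sorted₀ b≤t₀ s₀≤t₀ near eq
    ... | inj₂ t₀≤s₀ = Sum.map (subst (_< f s + f t) (+-comm (f t₀) (f s₀))) Sum.swap
      (balanced-sorted₀ b≤s₀ t₀≤s₀ (subst (_≤ 1) (∣-∣-comm s₀ t₀) near) (trans eq (+-comm s₀ t₀)))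

nC0≡1 : ∀ n → n C 0 ≡ 1
nC0≡1 n = trans (nCk≡nC[n∸k] {n = n} z≤n) (nCn≡1 n)

pascal : ∀ n k → suc n C suc k ≡ n C k + n C suc k
pascal n k = sym (nCk+nC[k+1]≡[n+1]C[k+1] n k)

0<nCk : ∀ {n k} → k ≤ n → 0 < n C k
0<nCk {n}     {zero}  _         = ≤-reflexive (sym (nC0≡1 n))
0<nCk {suc n} {suc k} (s≤s k≤n) = subst (0 <_) (sym (pascal n k)) (m≤n⇒m≤n+o _ (0<nCk k≤n))

C-step-≤ : ∀ n k → n C k ≤ suc n C k
C-step-≤ n zero    = ≤-reflexive (trans (nC0≡1 n) (sym (nC0≡1 (suc n))))
C-step-≤ n (suc k) = subst (n C suc k ≤_) (sym (pascal n k)) (m≤n+m _ _)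

C-monotone : ∀ k → Monotone (_C k)
C-monotone k {x} {y} x≤y = go (≤⇒≤′ x≤y)
  where
  go : ∀ {y} → x ≤′ y → x C k ≤ y C k
  go (≤′-reflexive refl) = ≤-refl
  go (≤′-step x≤′y)      = ≤-trans (go x≤′y) (C-step-≤ _ k)

C-increasing : ∀ k {x y} → x < y → k < y → x C suc k < y C suc k
C-increasing k {x} {suc y} (s≤s x≤y) (s≤s k≤y) = begin-strict
  x C suc k          ≤⟨ C-monotone (suc k) x≤y ⟩
  y C suc k          <⟨ +-monoˡ-< (y C suc k) (0<nCk k≤y) ⟩
  y C k + y C suc k  ≡⟨ pascal y k ⟨
  suc y C suc k      ∎
  where open ≤-Reasoning

-- By Pascal's rule C(-, k) is the difference sequence of C(-, k + 1), so monotonicity of the one is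
-- convexity of the other.
C-convex : ∀ k → Convex (_C suc k)
C-convex k = difference-monotone⇒convex (λ x → pascal x k) (C-monotone k)

C-strictlyConvex : ∀ k → StrictlyConvexFrom (suc k) (_C suc (suc k))
C-strictlyConvex k =
  difference-increasing⇒strictlyConvex (λ x → pascal x (suc k)) (C-increasing k)

module _ (m : ℕ) where

  -- The number of k-subsets of an (m + x)-set that are not contained in a given x-subset.
  crossing : ℕ → ℕ → ℕ
  crossing k x = (m + x) C k ∸ x C k

  -- Monotonicity of C(-, k) makes the truncated subtraction exact.
  crossing+C : ∀ k x → crossing k x + x C k ≡ (m + x) C k
  crossing+C k x = m∸n+n≡m (C-monotone k (m≤n+m x m))

  -- A difference of two functions obeying Pascal's rule obeys it too; adding `suc x C suc k` on
  -- both sides avoids computing with truncated subtraction.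
  crossing-pascal : ∀ k x → crossing (suc k) (suc x) ≡ crossing k x + crossing (suc k) x
  crossing-pascal k x = +-cancelʳ-≡ (suc x C suc k) _ _ (begin
    crossing (suc k) (suc x) + suc x C suc k
      ≡⟨ crossing+C (suc k) (suc x) ⟩
    (m + suc x) C suc k
      ≡⟨ cong (_C suc k) (+-suc m x) ⟩
    suc (m + x) C suc k
      ≡⟨ pascal (m + x) k ⟩
    (m + x) C k + (m + x) C suc k
      ≡⟨ cong₂ _+_ (crossing+C k x) (crossing+C (suc k) x) ⟨
    (crossing k x + x C k) + (crossing (suc k) x + x C suc k)
      ≡⟨ rearrange (crossing k x) (x C k) (crossing (suc k) x) (x C suc k) ⟩
    crossing k x + crossing (suc k) x + (x C k + x C suc k)
      ≡⟨ cong (crossing k x + crossing (suc k) x +_) (pascal x k) ⟨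
    crossing k x + crossing (suc k) x + suc x C suc k ∎)
    where
    open ≡-Reasoning
    rearrange : ∀ a b c d → (a + b) + (c + d) ≡ a + c + (b + d)
    rearrange = solve-∀

  0<crossing : ∀ k → k < m → ∀ x → 0 < crossing (suc k) x
  0<crossing k k<m x =
    m<n⇒0<n∸m (C-increasing k (m<n+m x (≤-<-trans z≤n k<m)) (<-≤-trans k<m (m≤m+n m x)))

  crossing-increasing : ∀ k → k < m → StrictlyMonotone (crossing (suc (suc k)))
  crossing-increasing k k<m {x} x<y = go (≤⇒≤′ x<y)
    where
    step : ∀ y → crossing (2 + k) y < crossing (2 + k) (suc y)
    step y = subst (crossing (2 + k) y <_) (sym (crossing-pascal (suc k) y))
                   (+-monoˡ-< (crossing (2 + k) y) (0<crossing k k<m y))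
    go : ∀ {y} → x <′ y → crossing (2 + k) x < crossing (2 + k) y
    go (≤′-reflexive refl) = step x
    go (≤′-step {y} x<′y)  = <-trans (go x<′y) (step y)

  -- Applying Pascal's rule twice, the second difference of `crossing (3 + k)` is
  -- `crossing (1 + k)`, which is positive. In contrast, `crossing 2` is linear, so this is where r
  -- ≥ 3 enters.
  crossing-strictlyConvex : ∀ k → k < m → StrictlyConvexFrom 0 (crossing (3 + k))
  crossing-strictlyConvex k k<m =
    difference-increasing⇒strictlyConvex (crossing-pascal (2 + k))
      (λ x<y _ → crossing-increasing k k<m x<y)

-- Color counts of the classes

∑ : ∀ {a} {A : Set a} → List A → (A → ℕ) → ℕ
∑ xs f = sum (map f xs)

module _ {a} {A : Set a} where

  ∑-cong : ∀ (xs : List A) {f g : A → ℕ} → (∀ x → f x ≡ g x) → ∑ xs f ≡ ∑ xs g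
  ∑-cong xs f≗g = cong sum (map-cong f≗g xs)

  ∑-++ : ∀ (xs ys : List A) f → ∑ (xs ++ ys) f ≡ ∑ xs f + ∑ ys f
  ∑-++ xs ys f = trans (cong sum (map-++ f xs ys)) (sum-++ (map f xs) (map f ys))

  ∑-map : ∀ {b} {B : Set b} (g : B → A) xs (f : A → ℕ) → ∑ (map g xs) f ≡ ∑ xs (f ∘ g)
  ∑-map g xs f = cong sum (sym (map-∘ xs))

  ∑-↭ : ∀ {xs ys : List A} f → xs ↭ ys → ∑ xs f ≡ ∑ ys f
  ∑-↭ f xs↭ys = sum-↭ (map⁺ f xs↭ys)

  ∑-replicate : ∀ q (x : A) f → ∑ (replicate q x) f ≡ q * f x
  ∑-replicate zero    x f = refl
  ∑-replicate (suc q) x f = cong (f x +_) (∑-replicate q x f)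

-- Profiles and the reduction to one mixed class

module Profiles
  (f : ℕ → ℕ) (convex : Convex f)
  {b n : ℕ} (b<n : b < n) (strict : StrictlyConvexFrom b f)
  where

  -- One pair of red and blue counts per class. In the application f is C(-, r), so `spread` counts
  -- the r-sets of one color and `value` those of them inside a single class.
  Profile : Set
  Profile = List (ℕ × ℕ)

  pairValue : ℕ × ℕ → ℕ
  pairValue (s , t) = f s + f t

  reds blues value spread : Profile → ℕ
  reds     L = ∑ L proj₁
  blues    L = ∑ L proj₂
  value    L = ∑ L pairValue
  spread   L = f (reds L) + f (blues L)

  HasSize : ℕ × ℕ → Set
  HasSize (s , t) = s + t ≡ n

  -- Equal color totals and, unless N merely reorders L, strictly fewer monochromatic edges in N.
  record _≼_ (L N : Profile) : Set where
    constructor mk≼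
    field
      reds-≡  : reds L ≡ reds N
      blues-≡ : blues L ≡ blues N
      gain    : value L < value N ⊎ L ↭ N

  ↭⇒≼ : ∀ {L N} → L ↭ N → L ≼ N
  ↭⇒≼ L↭N = mk≼ (∑-↭ proj₁ L↭N) (∑-↭ proj₂ L↭N) (inj₂ L↭N)

  ≼-trans : ∀ {L N O} → L ≼ N → N ≼ O → L ≼ O
  ≼-trans {L} {N} {O} (mk≼ r₁ b₁ g₁) (mk≼ r₂ b₂ g₂) =
    mk≼ (trans r₁ r₂) (trans b₁ b₂) (gain g₁ g₂)
    where
    gain : value L < value N ⊎ L ↭ N → value N < value O ⊎ N ↭ O → value L < value O ⊎ L ↭ O
    gain (inj₁ v) (inj₁ w) = inj₁ (<-trans v w)
    gain (inj₁ v) (inj₂ q) = inj₁ (<-≤-trans v (≤-reflexive (∑-↭ pairValue q)))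
    gain (inj₂ p) (inj₁ w) = inj₁ (≤-<-trans (≤-reflexive (∑-↭ pairValue p)) w)
    gain (inj₂ p) (inj₂ q) = inj₂ (↭-trans p q)

  ≼-∷ : ∀ p {L N} → L ≼ N → (p ∷ L) ≼ (p ∷ N)
  ≼-∷ p (mk≼ r b g) = mk≼ (cong (proj₁ p +_) r) (cong (proj₂ p +_) b)
    (Sum.map (+-monoʳ-< (pairValue p)) (↭-prep p) g)

  ≼-exchange : ∀ p q x y → proj₁ p + proj₁ q ≡ proj₁ x + proj₁ y →
               proj₂ p + proj₂ q ≡ proj₂ x + proj₂ y →
               pairValue p + pairValue q < pairValue x + pairValue y →
               ∀ E → (p ∷ q ∷ E) ≼ (x ∷ y ∷ E)
  ≼-exchange p q x y r b v E = mk≼ (reassoc proj₁ r) (reassoc proj₂ b)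
    (inj₁ (subst₂ _<_ (+-assoc (pairValue p) _ _) (+-assoc (pairValue x) _ _)
      (+-monoˡ-< (value E) v)))
    where
    reassoc : ∀ h → h p + h q ≡ h x + h y → ∑ (p ∷ q ∷ E) h ≡ ∑ (x ∷ y ∷ E) h
    reassoc h eq = trans (sym (+-assoc (h p) (h q) _))
      (trans (cong (_+ ∑ E h) eq) (+-assoc (h x) (h y) _))

  -- Convexity is applied to each color separately: the red counts a, a′ spread out to 0, a + a′,
  -- and the blue counts a′ + c, a + c spread out to c, n. The blue inequality is strict.
  merge-value : ∀ a a′ c → 0 < a → 0 < a′ → a + a′ + c ≡ n →
                (f a + f (a′ + c)) + (f a′ + f (a + c)) < (f 0 + f n) + (f (a + a′) + f c)
  merge-value (suc a) a′ c _ 0<a′ refl = subst₂ _<_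
    (lhs (f (suc a)) (f a′) (f (suc a + c)) (f (a′ + c)))
    (trans (cong (λ z → f 0 + f (suc a + a′) + (f c + f z)) (sym (+-assoc (suc a) a′ c)))
           (rhs (f 0) (f (suc a + a′)) (f c) (f (suc a + a′ + c))))
    (+-mono-≤-<
      (subst (λ z → f z + f a′ ≤ f 0 + f (suc a + a′)) (+-identityʳ (suc a))
        (convex-shift f convex z≤n (suc a)))
      -- The last unit step starts at n - 1, so b < n supplies the threshold.
      (convex-shift-strict f convex strict (m<n+m c 0<a′) a
        (subst (b ≤_) (+-assoc a a′ c) (s≤s⁻¹ b<n))))
    where
    lhs : ∀ p q u v → (p + q) + (u + v) ≡ (p + v) + (q + u)
    lhs = solve-∀
    rhs : ∀ p q u v → (p + q) + (u + v) ≡ (p + v) + (q + u)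
    rhs = solve-∀

  Extreme : ℕ × ℕ → Set
  Extreme x = x ≡ (n , 0) ⊎ x ≡ (0 , n)

  Merge : (p q : ℕ × ℕ) → Set
  Merge p q = ∃[ x ] ∃[ y ] (Extreme x × HasSize y × (∀ E → (p ∷ q ∷ E) ≼ (x ∷ y ∷ E)))

  -- If one of the classes is already monochromatic, at most their order changes. Otherwise the two
  -- classes have 2n vertices, so some color occurs at most n times in them; gathering that color in
  -- one class leaves the other class monochromatic.
  merge : ∀ p q → HasSize p → HasSize q → Merge p q
  merge p@(zero , t) q p-size q-size =
    p , q , inj₂ (cong (0 ,_) p-size) , q-size , λ E → ↭⇒≼ ↭-refl
  merge p@(suc s , zero) q p-size q-size =
    p , q , inj₁ (cong (_, 0) (trans (sym (+-identityʳ (suc s))) p-size)) , q-size ,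
    λ E → ↭⇒≼ ↭-refl
  merge p@(suc _ , suc _) q@(zero , t) p-size q-size =
    q , p , inj₂ (cong (0 ,_) q-size) , p-size , λ E → ↭⇒≼ (↭-swap p q ↭-refl)
  merge p@(suc _ , suc _) q@(suc s , zero) p-size q-size =
    q , p , inj₁ (cong (_, 0) (trans (sym (+-identityʳ (suc s))) q-size)) , p-size ,
    λ E → ↭⇒≼ (↭-swap p q ↭-refl)
  merge p@(a@(suc _) , b@(suc _)) q@(a′@(suc _) , b′@(suc _)) p-size q-size
    with ≤-total (a + a′) n
  ... | inj₁ a+a′≤n with m≤n⇒∃[o]m+o≡n a+a′≤n
  -- All red vertices go to the second class, and c is the number of blue vertices that still fit
  -- there.
  ...   | c , eq = (0 , n) , (a + a′ , c) , inj₂ refl , eq ,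
    ≼-exchange p q _ _ refl b+b′≡n+c
      (subst₂ (λ u v → (f a + f u) + (f a′ + f v) < f 0 + f n + (f (a + a′) + f c))
        (sym b≡) (sym b′≡)
        (merge-value a a′ c z<s z<s eq))
    where
    b≡ : b ≡ a′ + c
    b≡ = +-cancelˡ-≡ a _ _ (trans p-size (trans (sym eq) (+-assoc a a′ c)))
    rotate : ∀ a a′ c → a + a′ + c ≡ a′ + (a + c)
    rotate = solve-∀
    b′≡ : b′ ≡ a + c
    b′≡ = +-cancelˡ-≡ a′ _ _ (trans q-size (trans (sym eq) (rotate a a′ c)))
    regroup : ∀ a a′ c → (a′ + c) + (a + c) ≡ a + a′ + c + c
    regroup = solve-∀
    b+b′≡n+c : b + b′ ≡ n + c
    b+b′≡n+c = trans (cong₂ _+_ b≡ b′≡) (trans (regroup a a′ c) (cong (_+ c) eq))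
  merge p@(a@(suc _) , b@(suc _)) q@(a′@(suc _) , b′@(suc _)) p-size q-size
      | inj₂ n≤a+a′ with m≤n⇒∃[o]m+o≡n b+b′≤n
    where
    regroup : ∀ a a′ b b′ → (a + b) + (a′ + b′) ≡ (a + a′) + (b + b′)
    regroup = solve-∀
    b+b′≤n : b + b′ ≤ n
    b+b′≤n = +-cancelˡ-≤ n _ _ (begin
      n + (b + b′)         ≤⟨ +-monoˡ-≤ (b + b′) n≤a+a′ ⟩
      a + a′ + (b + b′)    ≡⟨ regroup a a′ b b′ ⟨
      (a + b) + (a′ + b′)  ≡⟨ cong₂ _+_ p-size q-size ⟩
      n + n                ∎)
      where open ≤-Reasoning
  -- The mirror image: all blue vertices go to the second class, together with c red ones.
  ...   | c , eq = (n , 0) , (c , b + b′) , inj₁ refl , trans (+-comm c (b + b′)) eq ,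
    ≼-exchange p q _ _ a+a′≡n+c refl
      (subst₂ _<_ (lhs (f b) (f a) (f b′) (f a′)) (lhs (f 0) (f n) (f (b + b′)) (f c))
        (subst₂ (λ u v → (f b + f u) + (f b′ + f v) < f 0 + f n + (f (b + b′) + f c))
          (sym a≡) (sym a′≡)
          (merge-value b b′ c z<s z<s eq)))
    where
    lhs : ∀ p q u v → (p + q) + (u + v) ≡ (q + p) + (v + u)
    lhs = solve-∀
    rotate₁ : ∀ b b′ c → b + b′ + c ≡ b′ + c + b
    rotate₁ = solve-∀
    a≡ : a ≡ b′ + c
    a≡ = +-cancelʳ-≡ b _ _ (trans p-size (trans (sym eq) (rotate₁ b b′ c)))
    rotate₂ : ∀ b b′ c → b + b′ + c ≡ b + c + b′
    rotate₂ = solve-∀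
    a′≡ : a′ ≡ b + c
    a′≡ = +-cancelʳ-≡ b′ _ _ (trans q-size (trans (sym eq) (rotate₂ b b′ c)))
    regroup : ∀ b b′ c → (b′ + c) + (b + c) ≡ b + b′ + c + c
    regroup = solve-∀
    a+a′≡n+c : a + a′ ≡ n + c
    a+a′≡n+c = trans (cong₂ _+_ a≡ a′≡) (trans (regroup b b′ c) (cong (_+ c) eq))

  extremes : ℕ → ℕ → Profile
  extremes q q′ = replicate q (n , 0) ++ replicate q′ (0 , n)

  -- Induction on the number of classes. The rest is first reduced to one possibly mixed class at
  -- the head; merging the new class with it yields another monochromatic class and again a single
  -- possibly mixed one.
  canonical : ∀ p L → All HasSize (p ∷ L) →
              ∃[ s ] ∃[ t ] ∃[ q ] ∃[ q′ ]
                (s + t ≡ n × q + q′ ≡ length L × (p ∷ L) ≼ ((s , t) ∷ extremes q q′))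
  canonical (s , t) []      (p-size ∷ []) = s , t , 0 , 0 , p-size , refl , ↭⇒≼ ↭-refl
  canonical p       (p′ ∷ L) (p-size ∷ L-size) with canonical p′ L L-size
  ... | s , t , q , q′ , size , len , L≼ with merge p (s , t) p-size size
  ...   | x , y@(s′ , t′) , extreme , y-size , step = result extreme
    where
    pL≼ : (p ∷ p′ ∷ L) ≼ (y ∷ x ∷ extremes q q′)
    pL≼ = ≼-trans (≼-∷ p L≼) (≼-trans (step _) (↭⇒≼ (↭-swap x y ↭-refl)))
    result : Extreme x → ∃[ s ] ∃[ t ] ∃[ q ] ∃[ q′ ]
      (s + t ≡ n × q + q′ ≡ suc (length L) × (p ∷ p′ ∷ L) ≼ ((s , t) ∷ extremes q q′))
    result (inj₁ refl) = s′ , t′ , suc q , q′ , y-size , cong suc len , pL≼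
    result (inj₂ refl) = s′ , t′ , q , suc q′ , y-size , trans (+-suc q q′) (cong suc len) ,
      ≼-trans pL≼ (↭⇒≼ (↭-prep y (↭-sym (shift x (replicate q (n , 0)) (replicate q′ x)))))

  -- Comparison of profiles by monochromatic edges

  infix 4 _≼_ _⊑_

  -- The number of monochromatic edges of a coloring with profile L is spread L - value L.
  _⊑_ : Profile → Profile → Set
  L₀ ⊑ L = spread L₀ + value L < spread L + value L₀ ⊎ (L₀ ↭ L ⊎ map Product.swap L₀ ↭ L)

  spread-cong : ∀ {L N} → reds L ≡ reds N → blues L ≡ blues N → spread L ≡ spread N
  spread-cong r b = cong₂ (λ u v → f u + f v) r b

  spread-↭ : ∀ {L N} → L ↭ N → spread L ≡ spread N
  spread-↭ {L} {N} L↭N = spread-cong {L} {N} (∑-↭ proj₁ L↭N) (∑-↭ proj₂ L↭N)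

  spread-swap : ∀ L → spread (map Product.swap L) ≡ spread L
  spread-swap L = trans
    (cong₂ (λ u v → f u + f v) (∑-map Product.swap L proj₁) (∑-map Product.swap L proj₂))
    (+-comm (f (blues L)) (f (reds L)))

  value-swap : ∀ L → value (map Product.swap L) ≡ value L
  value-swap L = trans (∑-map Product.swap L pairValue)
                       (∑-cong L (λ (s , t) → +-comm (f t) (f s)))

  ⊑-weaken : ∀ {L₀ N} → L₀ ⊑ N → spread L₀ + value N ≤ spread N + value L₀
  ⊑-weaken (inj₁ better) = <⇒≤ better
  ⊑-weaken (inj₂ (inj₁ L₀↭N)) =
    ≤-reflexive (cong₂ _+_ (spread-↭ L₀↭N) (sym (∑-↭ pairValue L₀↭N)))
  ⊑-weaken {L₀} (inj₂ (inj₂ sL₀↭N)) = ≤-reflexive (cong₂ _+_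
    (trans (sym (spread-swap L₀)) (spread-↭ sL₀↭N))
    (trans (sym (∑-↭ pairValue sL₀↭N)) (value-swap L₀)))

  -- A gain from L to N keeps the spread and raises the value, so L has more monochromatic edges
  -- than N and loses strictly to L₀. A mere reordering changes nothing.
  ⊑-≼ : ∀ {L₀ L N} → L₀ ⊑ N → L ≼ N → L₀ ⊑ L
  ⊑-≼ {L₀} {L} {N} L₀⊑N (mk≼ r b (inj₁ v)) = inj₁ (begin-strict
    spread L₀ + value L  <⟨ +-monoʳ-< (spread L₀) v ⟩
    spread L₀ + value N  ≤⟨ ⊑-weaken L₀⊑N ⟩
    spread N + value L₀  ≡⟨ cong (_+ value L₀) (spread-cong {L} {N} r b) ⟨
    spread L + value L₀  ∎)
    where open ≤-Reasoning
  ⊑-≼ {L₀} (inj₁ better) (mk≼ _ _ (inj₂ p)) = inj₁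
    (subst₂ (λ u v → spread L₀ + u < v + value L₀)
      (sym (∑-↭ pairValue p)) (sym (spread-↭ p)) better)
  ⊑-≼ (inj₂ q) (mk≼ _ _ (inj₂ p)) =
    inj₂ (Sum.map (λ z → ↭-trans z (↭-sym p)) (λ z → ↭-trans z (↭-sym p)) q)

  ⊑-respˡ-↭ : ∀ {L₀ L₁ L} → L₀ ↭ L₁ → L₀ ⊑ L → L₁ ⊑ L
  ⊑-respˡ-↭ {L = L} p (inj₁ better) = inj₁ (subst₂ (λ u v → u + value L < spread L + v)
    (spread-↭ p) (∑-↭ pairValue p) better)
  ⊑-respˡ-↭ p (inj₂ q) = inj₂ (Sum.map (↭-trans (↭-sym p))
    (↭-trans (↭-sym (map⁺ Product.swap p))) q)

  -- Monochromatic classes and an even number of classes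

  ∑-extremes : ∀ q q′ h → ∑ (extremes q q′) h ≡ q * h (n , 0) + q′ * h (0 , n)
  ∑-extremes q q′ h = trans (∑-++ (replicate q (n , 0)) (replicate q′ (0 , n)) h)
    (cong₂ _+_ (∑-replicate q (n , 0) h) (∑-replicate q′ (0 , n) h))

  reds-extremes : ∀ q q′ → reds (extremes q q′) ≡ q * n
  reds-extremes q q′ = trans (∑-extremes q q′ proj₁)
    (trans (cong (q * n +_) (*-zeroʳ q′)) (+-identityʳ (q * n)))

  blues-extremes : ∀ q q′ → blues (extremes q q′) ≡ q′ * n
  blues-extremes q q′ = trans (∑-extremes q q′ proj₂) (cong (_+ q′ * n) (*-zeroʳ q))

  value-extremes : ∀ q q′ → value (extremes q q′) ≡ (q + q′) * (f 0 + f n)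
  value-extremes q q′ = trans (∑-extremes q q′ pairValue)
    (trans (cong (λ z → q * z + q′ * (f 0 + f n)) (+-comm (f n) (f 0)))
           (sym (*-distribʳ-+ (f 0 + f n) q q′)))

  pairValue-≤ : ∀ {s t} → s + t ≡ n → pairValue (s , t) ≤ f 0 + f n
  pairValue-≤ {s} {t} eq = subst₂ (λ u v → f u + f t ≤ f 0 + f v) (+-identityʳ s) eq
    (convex-shift f convex z≤n s)

  pairValue-< : ∀ {s t} → s + t ≡ n → 0 < s → 0 < t → pairValue (s , t) < f 0 + f n
  pairValue-< {suc s} {t} refl _ 0<t =
    subst (λ u → f u + f t < f 0 + f (suc s + t)) (+-identityʳ (suc s))
      (convex-shift-strict f convex strict 0<t s (s≤s⁻¹ b<n))

  b≤m*n : ∀ {m} → 0 < m → b ≤ m * n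
  b≤m*n {suc m} _ = ≤-trans (<⇒≤ b<n) (m≤m+n n (m * n))

  0<n : 0 < n
  0<n = ≤-<-trans z≤n b<n

  -- The distinguished class of a canonical profile may itself be monochromatic. This lemma and the
  -- next put it back among the extremes.
  extremes-∷-blue : ∀ {m q q′ t} → t ≡ n → q ≡ m → suc q′ ≡ m →
                    extremes m m ↭ (0 , t) ∷ extremes q q′
  extremes-∷-blue {q = q} {q′} refl refl refl =
    shift (0 , n) (replicate q (n , 0)) (replicate q′ (0 , n))

  extremes-∷-red : ∀ {m q q′ s} → s ≡ n → suc q ≡ m → q′ ≡ m →
                   extremes m m ↭ (s , 0) ∷ extremes q q′
  extremes-∷-red refl refl refl = ↭-refl

  sizes-total : ∀ s t q q′ → s + t ≡ n → (s + q * n) + (t + q′ * n) ≡ n + (q + q′) * n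
  sizes-total s t q q′ size =
    trans (regroup s t q q′ n) (cong (_+ (q + q′) * n) size)
    where
    regroup : ∀ s t q q′ n → (s + q * n) + (t + q′ * n) ≡ (s + t) + (q + q′) * n
    regroup = solve-∀

  spread-canonical : ∀ s t q q′ →
                     spread ((s , t) ∷ extremes q q′) ≡ f (s + q * n) + f (t + q′ * n)
  spread-canonical s t q q′ =
    cong₂ (λ u v → f (s + u) + f (t + v)) (reds-extremes q q′) (blues-extremes q q′)

  value-canonical : ∀ s t q q′ →
                    value ((s , t) ∷ extremes q q′) ≡ pairValue (s , t) + (q + q′) * (f 0 + f n)
  value-canonical s t q q′ = cong (pairValue (s , t) +_) (value-extremes q q′)

  -- Every profile is dominated by a canonical one, and `⊑-≼` carries the comparison back.
  ⊑-canonical⇒⊑ : ∀ {L₀ l} →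
    (∀ {s t q q′} → s + t ≡ n → suc (q + q′) ≡ suc l → L₀ ⊑ (s , t) ∷ extremes q q′) →
    ∀ L → All HasSize L → length L ≡ suc l → L₀ ⊑ L
  ⊑-canonical⇒⊑ L₀⊑ (p ∷ L) sizes len with canonical p L sizes
  ... | s , t , q , q′ , size , len′ , L≼N =
    ⊑-≼ (L₀⊑ {q = q} {q′} size (trans (cong suc len′) len)) L≼N

  -- Equal color totals minimize the spread and monochromatic classes maximize the value;
  -- `extremes m m` attains both at once.
  even-optimal : ∀ m {s t q q′} → 0 < m → s + t ≡ n → suc (q + q′) ≡ m + m →
                 extremes m m ⊑ (s , t) ∷ extremes q q′
  even-optimal m {s} {t} {q} {q′} 0<m size len = cases
    (balanced f convex strict (b≤m*n 0<m) (b≤m*n 0<m)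
      (subst (_≤ 1) (sym (m≡n⇒∣m-n∣≡0 {m * n} refl)) z≤n) total)
    where
    N = (s , t) ∷ extremes q q′
    e = f 0 + f n
    A = s + q * n
    B = t + q′ * n
    instance
      n-nonZero : NonZero n
      n-nonZero = >-nonZero 0<n

    total : A + B ≡ m * n + m * n
    total = begin
      A + B             ≡⟨ sizes-total s t q q′ size ⟩
      suc (q + q′) * n  ≡⟨ cong (_* n) len ⟩
      (m + m) * n       ≡⟨ *-distribʳ-+ n m m ⟩
      m * n + m * n     ∎
      where open ≡-Reasoning

    spread-L₀ : spread (extremes m m) ≡ f (m * n) + f (m * n)
    spread-L₀ = cong₂ (λ u v → f u + f v) (reds-extremes m m) (blues-extremes m m)
    -- One summand e is split off to be compared with the value of (s , t).
    value-L₀ : value (extremes m m) ≡ e + (q + q′) * e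
    value-L₀ = trans (value-extremes m m) (cong (_* e) (sym len))

    better : f (m * n) + f (m * n) + (pairValue (s , t) + (q + q′) * e)
               < f A + f B + (e + (q + q′) * e) → extremes m m ⊑ N
    better = inj₁ ∘ subst₂ _<_ (sym (cong₂ _+_ spread-L₀ (value-canonical s t q q′)))
                               (sym (cong₂ _+_ (spread-canonical s t q q′) value-L₀))

    -- The spreads agree, so the class (s , t) decides: if it is mixed, the value is strictly
    -- smaller; if not, cancelling n in the totals gives m classes of each color.
    concentrated : A ≡ m * n → B ≡ m * n → extremes m m ⊑ N
    concentrated A≡ B≡ with s ≟ 0 | t ≟ 0
    ... | yes refl | _ = inj₂ (inj₁ (extremes-∷-blue size (*-cancelʳ-≡ q m n A≡)
      (*-cancelʳ-≡ (suc q′) m n (subst (λ z → z + q′ * n ≡ m * n) size B≡))))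
    ... | no _ | yes refl = inj₂ (inj₁ (extremes-∷-red s≡n
      (*-cancelʳ-≡ (suc q) m n (subst (λ z → z + q * n ≡ m * n) s≡n A≡))
      (*-cancelʳ-≡ q′ m n B≡)))
      where
      s≡n : s ≡ n
      s≡n = trans (sym (+-identityʳ s)) size
    ... | no s≢0 | no t≢0 = better (+-mono-≤-<
      (≤-reflexive (cong₂ (λ u v → f u + f v) (sym A≡) (sym B≡)))
      (+-monoˡ-< ((q + q′) * e) (pairValue-< size (n≢0⇒n>0 s≢0) (n≢0⇒n>0 t≢0))))

    cases : f (m * n) + f (m * n) < f A + f B ⊎
            (A ≡ m * n × B ≡ m * n) ⊎ (A ≡ m * n × B ≡ m * n) →
            extremes m m ⊑ N
    cases (inj₁ v) = better (+-mono-<-≤ v (+-monoˡ-≤ ((q + q′) * e) (pairValue-≤ size)))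
    cases (inj₂ (inj₁ (A≡ , B≡))) = concentrated A≡ B≡
    cases (inj₂ (inj₂ (A≡ , B≡))) = concentrated A≡ B≡

  -- Odd number of classes

  swap-extremes : ∀ q q′ → map Product.swap (extremes q q′) ↭ extremes q′ q
  swap-extremes q q′ = ↭-trans (↭-reflexive (trans
    (map-++ Product.swap (replicate q (n , 0)) (replicate q′ (0 , n)))
    (cong₂ _++_ (map-replicate Product.swap q (n , 0)) (map-replicate Product.swap q′ (0 , n)))))
    (++-comm (replicate q (0 , n)) (replicate q′ (n , 0)))

  -- `φ M x` stands for f(M + x) - f x, specified additively by `φ+f`; `crossing` provides it for
  -- binomial coefficients.
  module _
    (φ : ℕ → ℕ → ℕ) (φ+f : ∀ M x → φ M x + f x ≡ f (M + x))
    (φ-strict : ∀ M → n ≤ M → StrictlyConvexFrom 0 (φ M))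
    (1<n : 1 < n)
    {m : ℕ} (0<m : 0 < m) {s₀ t₀ : ℕ} (size₀ : s₀ + t₀ ≡ n) (near : ∣ s₀ - t₀ ∣ ≤ 1)
    where

    private
      M = m * n

      n≤M : n ≤ M
      n≤M = m≤n*m n m
        where instance _ = >-nonZero 0<m

      -- The comparison of (s₀ , t₀) ∷ extremes m m with a mixed class (s , t) next to q red and q′ blue
      -- classes, for A = s + q * n and B = t + q′ * n, with the common value of the extremes cancelled.
      IsBeatenBy : (s t A B : ℕ) → Set
      IsBeatenBy s t A B =
        f (s₀ + M) + f (t₀ + M) + pairValue (s , t) < f A + f B + pairValue (s₀ , t₀)

      -- With m full classes of each color, spread minus pair value is φ(s) + φ(t), so `balanced`
      -- applies to the strictly convex φ.
      same-extremes : ∀ {s t} → s + t ≡ n →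
        IsBeatenBy s t (s + M) (t + M) ⊎ (s ≡ s₀ × t ≡ t₀) ⊎ (s ≡ t₀ × t ≡ s₀)
      same-extremes {s} {t} size =
        Sum.map₁ beaten (balanced (φ M) (strictlyConvex⇒convex {φ M} (φ-strict M n≤M))
          (φ-strict M n≤M) z≤n z≤n near (trans size (sym size₀)))
        where
        φ+f′ : ∀ x → f (x + M) ≡ φ M x + f x
        φ+f′ x = trans (cong f (+-comm x M)) (sym (φ+f M x))
        expand : ∀ x y u v →
          f (x + M) + f (y + M) + (u + v) ≡ φ M x + φ M y + (f x + f y + (u + v))
        expand x y u v = trans (cong₂ (λ p q → p + q + (u + v)) (φ+f′ x) (φ+f′ y))
                               (regroup (φ M x) (f x) (φ M y) (f y) (u + v))
          where
          regroup : ∀ p a q b w → (p + a) + (q + b) + w ≡ (p + q) + (a + b + w)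
          regroup = solve-∀
        beaten : φ M s₀ + φ M t₀ < φ M s + φ M t → IsBeatenBy s t (s + M) (t + M)
        beaten v = subst₂ _<_
          (sym (expand s₀ t₀ (f s) (f t)))
          (trans (cong (φ M s + φ M t +_) (+-comm (f s₀ + f t₀) (f s + f t)))
                 (sym (expand s t (f s₀) (f t₀))))
          (+-monoˡ-< (f s₀ + f t₀ + (f s + f t)) v)

      -- The competitor has m + 1 red and m blue classes. The equality cases would give s₀ and t₀
      -- the values n and 0, whose difference exceeds 1.
      red-middle : IsBeatenBy n 0 (n + M) M
      red-middle with same-extremes (+-identityʳ n)
      ... | inj₁ v = v
      ... | inj₂ (inj₁ (refl , refl)) =
        contradiction (≤-trans 1<n (subst (_≤ 1) (∣-∣-identityʳ n) near)) 1+n≰n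
      ... | inj₂ (inj₂ (refl , refl)) = contradiction (≤-trans 1<n near) 1+n≰n

      -- The comparison passes through m + 1 red and m blue classes: that pair value is the largest
      -- possible, and that spread is at most the given one because its totals are closer together.
      -- `red-middle` makes the comparison strict.
      more-red : ∀ {s t q q′} → s + t ≡ n → q + q′ ≡ m + m → m < q →
                 IsBeatenBy s t (s + q * n) (t + q′ * n)
      more-red {s} {t} {q} {q′} size len m<q with m≤n⇒∃[o]m+o≡n n+M≤A
        where
        n+M≤A : n + M ≤ s + q * n
        n+M≤A = ≤-trans (*-monoˡ-≤ n m<q) (m≤n+m (q * n) s)
      ... | e , eq = begin-strict
        f (s₀ + M) + f (t₀ + M) + (f s + f t)
          ≤⟨ +-monoʳ-≤ (f (s₀ + M) + f (t₀ + M)) (pairValue-≤ size) ⟩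
        f (s₀ + M) + f (t₀ + M) + (f 0 + f n)
          ≡⟨ cong (f (s₀ + M) + f (t₀ + M) +_) (+-comm (f 0) (f n)) ⟩
        f (s₀ + M) + f (t₀ + M) + (f n + f 0)
          <⟨ red-middle ⟩
        f (n + M) + f M + (f s₀ + f t₀)
          ≤⟨ +-monoˡ-≤ (f s₀ + f t₀) spread-≤ ⟩
        f (s + q * n) + f (t + q′ * n) + (f s₀ + f t₀) ∎
        where
        open ≤-Reasoning
        B = t + q′ * n
        -- The excess e of the red total over n + M is the deficit of the blue total below M.
        e+B≡M : e + B ≡ M
        e+B≡M = +-cancelˡ-≡ (n + M) _ _ (begin-equality
          n + M + (e + B)    ≡⟨ +-assoc (n + M) e B ⟨
          n + M + e + B      ≡⟨ cong (_+ B) eq ⟩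
          s + q * n + B      ≡⟨ sizes-total s t q q′ size ⟩
          n + (q + q′) * n   ≡⟨ cong (λ z → n + z * n) len ⟩
          n + (m + m) * n    ≡⟨ cong (n +_) (*-distribʳ-+ n m m) ⟩
          n + (M + M)        ≡⟨ +-assoc n M M ⟨
          n + M + M          ∎)
        spread-≤ : f (n + M) + f M ≤ f (s + q * n) + f B
        spread-≤ = subst₂ _≤_
          (trans (cong (λ z → f z + f (n + M)) e+B≡M) (+-comm (f M) (f (n + M))))
          (trans (cong (λ z → f B + f z) (trans (+-comm e (n + M)) eq)) (+-comm (f B) _))
          (convex-shift f convex (≤-trans (subst (B ≤_) e+B≡M (m≤n+m B e)) (m≤n+m M n)) e)

      unequal-extremes : ∀ {s t q q′} → s + t ≡ n → q + q′ ≡ m + m → q ≢ m →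
                         IsBeatenBy s t (s + q * n) (t + q′ * n)
      unequal-extremes {s} {t} {q} {q′} size len q≢m with <-cmp q m
      ... | tri≈ _ q≡m _ = contradiction q≡m q≢m
      ... | tri> _ _ m<q = more-red size len m<q
      -- With the colors exchanged, q′ > m takes the role of q.
      ... | tri< q<m _ _ = subst₂ _<_
        (cong (f (s₀ + M) + f (t₀ + M) +_) (+-comm (f t) (f s)))
        (cong (_+ pairValue (s₀ , t₀)) (+-comm (f (t + q′ * n)) (f (s + q * n))))
        (more-red (trans (+-comm t s) size) (trans (+-comm q′ q) len) m<q′)
        where
        m<q′ : m < q′
        m<q′ = ≰⇒> λ q′≤m → <⇒≢ (+-mono-<-≤ q<m q′≤m) len

      beaten⇒⊑ : ∀ s t q q′ → q + q′ ≡ m + m →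
                 IsBeatenBy s t (s + q * n) (t + q′ * n) →
                 (s₀ , t₀) ∷ extremes m m ⊑ (s , t) ∷ extremes q q′
      beaten⇒⊑ s t q q′ len v = inj₁ (subst₂ _<_
        (trans (+-assoc (f (s₀ + M) + f (t₀ + M)) (pairValue (s , t)) _)
          (sym (cong₂ _+_ (spread-canonical s₀ t₀ m m) (trans (value-canonical s t q q′)
            (cong (λ z → pairValue (s , t) + z * (f 0 + f n)) len)))))
        (trans (+-assoc (f (s + q * n) + f (t + q′ * n)) (pairValue (s₀ , t₀)) _)
          (sym (cong₂ _+_ (spread-canonical s t q q′) (value-canonical s₀ t₀ m m))))
        (+-monoˡ-< ((m + m) * (f 0 + f n)) v))

    odd-optimal : ∀ {s t q q′} → s + t ≡ n → q + q′ ≡ m + m →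
                  (s₀ , t₀) ∷ extremes m m ⊑ (s , t) ∷ extremes q q′
    odd-optimal {s} {t} {q} {q′} size len with q ≟ m
    ... | no q≢m = beaten⇒⊑ s t q q′ len (unequal-extremes size len q≢m)
    ... | yes refl with +-cancelˡ-≡ q q′ q len
    ...   | refl with same-extremes size
    ...     | inj₁ v = beaten⇒⊑ s t q q len v
    ...     | inj₂ (inj₁ (refl , refl)) = inj₂ (inj₁ ↭-refl)
    -- The middle class has its counts reversed, so equality holds after swapping the colors.
    ...     | inj₂ (inj₂ (refl , refl)) = inj₂ (inj₂ (↭-prep _ (swap-extremes m m)))

-- Counting by indicator functions

module _ {a} {A : Set a} where

  ∑-+ : ∀ (xs : List A) f g → ∑ xs (λ x → f x + g x) ≡ ∑ xs f + ∑ xs g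
  ∑-+ []       f g = refl
  ∑-+ (x ∷ xs) f g = trans (cong (f x + g x +_) (∑-+ xs f g))
                           (interchange (f x) (g x) (∑ xs f) (∑ xs g))
    where
    interchange : ∀ p q s t → (p + q) + (s + t) ≡ (p + s) + (q + t)
    interchange = solve-∀

  ∑-zero : ∀ (xs : List A) {f} → (∀ x → f x ≡ 0) → ∑ xs f ≡ 0
  ∑-zero []       f≡0 = refl
  ∑-zero (x ∷ xs) f≡0 = cong₂ _+_ (f≡0 x) (∑-zero xs f≡0)

∑-comm : ∀ {a b} {A : Set a} {B : Set b} (xs : List A) (ys : List B) (f : A → B → ℕ) →
         ∑ xs (λ x → ∑ ys (f x)) ≡ ∑ ys (λ y → ∑ xs (λ x → f x y))
∑-comm []       ys f = sym (∑-zero ys (λ _ → refl))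
∑-comm (x ∷ xs) ys f = trans (cong (∑ ys (f x) +_) (∑-comm xs ys f))
                             (sym (∑-+ ys (f x) (λ y → ∑ xs (λ x → f x y))))

∑-tabulate : ∀ {a} {A : Set a} {n} (g : Fin n → A) f → ∑ (tabulate g) f ≡ ∑ (allFin n) (f ∘ g)
∑-tabulate g f = cong sum (trans (map-tabulate g f) (sym (map-tabulate (λ i → i) (f ∘ g))))

∑-allFin-suc : ∀ {n} (f : Fin (suc n) → ℕ) →
               ∑ (allFin (suc n)) f ≡ f zero + ∑ (allFin n) (f ∘ suc)
∑-allFin-suc f = cong (f zero +_) (∑-tabulate suc f)

∑-allFin-+ : ∀ m {n} (f : Fin (m + n) → ℕ) →
             ∑ (allFin (m + n)) f ≡ ∑ (allFin m) (f ∘ (_↑ˡ n)) + ∑ (allFin n) (f ∘ (m ↑ʳ_))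
∑-allFin-+ zero    f = refl
∑-allFin-+ (suc m) {n} f = begin
  ∑ (allFin (suc m + n)) f
    ≡⟨ ∑-allFin-suc f ⟩
  f zero + ∑ (allFin (m + n)) (f ∘ suc)
    ≡⟨ cong (f zero +_) (∑-allFin-+ m (f ∘ suc)) ⟩
  f zero + (∑ (allFin m) (f ∘ suc ∘ (_↑ˡ n)) + ∑ (allFin n) (f ∘ suc ∘ (m ↑ʳ_)))
    ≡⟨ +-assoc (f zero) _ _ ⟨
  f zero + ∑ (allFin m) (f ∘ suc ∘ (_↑ˡ n)) + ∑ (allFin n) (f ∘ suc ∘ (m ↑ʳ_))
    ≡⟨ cong (_+ ∑ (allFin n) (f ∘ (suc m ↑ʳ_))) (∑-allFin-suc (f ∘ (_↑ˡ n))) ⟨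
  ∑ (allFin (suc m)) (f ∘ (_↑ˡ n)) + ∑ (allFin n) (f ∘ (suc m ↑ʳ_)) ∎
  where open ≡-Reasoning

∑-combine : ∀ k n (f : Fin (k * n) → ℕ) →
            ∑ (allFin (k * n)) f ≡ ∑ (allFin k) (λ i → ∑ (allFin n) (λ j → f (combine i j)))
∑-combine zero    n f = refl
∑-combine (suc k) n f = begin
  ∑ (allFin (n + k * n)) f
    ≡⟨ ∑-allFin-+ n f ⟩
  ∑ (allFin n) (f ∘ (_↑ˡ (k * n))) + ∑ (allFin (k * n)) (f ∘ (n ↑ʳ_))
    ≡⟨ cong (∑ (allFin n) (f ∘ (_↑ˡ (k * n))) +_) (∑-combine k n (f ∘ (n ↑ʳ_))) ⟩
  ∑ (allFin n) (f ∘ (_↑ˡ (k * n))) +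
  ∑ (allFin k) (λ i → ∑ (allFin n) (λ j → f (n ↑ʳ combine i j)))
    ≡⟨ ∑-allFin-suc {k} (λ i → ∑ (allFin n) (λ j → f (combine {suc k} i j))) ⟨
  ∑ (allFin (suc k)) (λ i → ∑ (allFin n) (λ j → f (combine i j))) ∎
  where open ≡-Reasoning

∑-one : ∀ n → ∑ (allFin n) (λ _ → 1) ≡ n
∑-one zero    = refl
∑-one (suc n) = trans (∑-allFin-suc {n} (λ _ → 1)) (cong suc (∑-one n))

module _ {p} {P : Set p} where

  𝟙 : Dec P → ℕ
  𝟙 p? = if does p? then 1 else 0

  𝟙-yes : P → (p? : Dec P) → 𝟙 p? ≡ 1
  𝟙-yes p (yes _) = refl
  𝟙-yes p (no ¬p) = contradiction p ¬p

  𝟙-no : ¬ P → (p? : Dec P) → 𝟙 p? ≡ 0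
  𝟙-no ¬p (yes p) = contradiction p ¬p
  𝟙-no ¬p (no _)  = refl

𝟙-cong : ∀ {p q} {P : Set p} {Q : Set q} → (P → Q) → (Q → P) →
         (p? : Dec P) (q? : Dec Q) → 𝟙 p? ≡ 𝟙 q?
𝟙-cong P⇒Q Q⇒P (yes p) q? = sym (𝟙-yes (P⇒Q p) q?)
𝟙-cong P⇒Q Q⇒P (no ¬p) q? = sym (𝟙-no (¬p ∘ Q⇒P) q?)

𝟙-⊎ : ∀ {p q s} {P : Set p} {Q : Set q} {S : Set s} →
      (P → Q ⊎ S) → (Q → P) → (S → P) → (Q → ¬ S) →
      (p? : Dec P) (q? : Dec Q) (s? : Dec S) → 𝟙 p? ≡ 𝟙 q? + 𝟙 s?
𝟙-⊎ split Q⇒P S⇒P disjoint p? (yes q) s? =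
  trans (𝟙-yes (Q⇒P q) p?) (sym (cong suc (𝟙-no (disjoint q) s?)))
𝟙-⊎ split Q⇒P S⇒P disjoint p? (no ¬q) s? =
  𝟙-cong (λ p → Sum.[ (λ q → contradiction q ¬q) , (λ s → s) ] (split p)) S⇒P p? s?

-- Exactly one summand is 1 if P holds, and none otherwise. Induction on n: once `Q zero` holds,
-- uniqueness makes all later summands vanish.
𝟙-∃! : ∀ {p q n} {P : Set p} {Q : Fin n → Set q} →
       (P → ∃[ i ] Q i) → (∀ i → Q i → P) → (∀ i j → Q i → Q j → i ≡ j) →
       (p? : Dec P) (q? : ∀ i → Dec (Q i)) → 𝟙 p? ≡ ∑ (allFin n) (λ i → 𝟙 (q? i))
𝟙-∃! {n = zero}  P⇒∃ Q⇒P unique p? q? = 𝟙-no (λ p → Fin.¬Fin0 (proj₁ (P⇒∃ p))) p?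
𝟙-∃! {n = suc n} {P = P} {Q} P⇒∃ Q⇒P unique p? q? =
  trans (first (q? zero)) (sym (∑-allFin-suc (λ i → 𝟙 (q? i))))
  where
  first : (q₀? : Dec (Q zero)) → 𝟙 p? ≡ 𝟙 q₀? + ∑ (allFin n) (λ i → 𝟙 (q? (suc i)))
  first (yes q₀) = trans (𝟙-yes (Q⇒P zero q₀) p?) (sym (cong suc
    (∑-zero (allFin n) (λ i → 𝟙-no (λ q → Fin.0≢1+n (unique zero (suc i) q₀ q)) (q? (suc i))))))
  first (no ¬q₀) = 𝟙-∃! P⇒∃′ (Q⇒P ∘ suc)
    (λ i j qᵢ qⱼ → Fin.suc-injective (unique (suc i) (suc j) qᵢ qⱼ)) p? (q? ∘ suc)
    where
    P⇒∃′ : P → ∃[ i ] Q (suc i)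
    P⇒∃′ p with P⇒∃ p
    ... | zero  , q = contradiction q ¬q₀
    ... | suc i , q = i , q

length-filter≡∑ : ∀ {a p} {A : Set a} {P : Pred A p} (P? : Decidable P) xs →
                  length (filter P? xs) ≡ ∑ xs (λ x → 𝟙 (P? x))
length-filter≡∑ P? []       = refl
length-filter≡∑ P? (x ∷ xs) with does (P? x)
... | true  = cong suc (length-filter≡∑ P? xs)
... | false = length-filter≡∑ P? xs

-- Counting subsets of a given size

_IsSubsetOfSize_In_ : ∀ {N} → Subset N → ℕ → (Fin N → Set) → Set
e IsSubsetOfSize r In P = ∣ e ∣ ≡ r × (∀ v → v ∈ e → P v)

isSubsetOfSize? : ∀ {N} {P : Fin N → Set} → Decidable P → ∀ r →
                  Decidable (_IsSubsetOfSize r In P)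
isSubsetOfSize? P? r e = (∣ e ∣ ≟ r) ×-dec Fin.all? (λ v → (v ∈? e) →-dec P? v)

-- Induction on N: subsets split by whether they contain the first vertex. If that vertex satisfies
-- P, the two counts combine by Pascal's rule; if not, no subset containing it qualifies.
#subsets : ∀ {N} {P : Fin N → Set} (P? : Decidable P) r →
           ∑ (allSubsets N) (λ e → 𝟙 (isSubsetOfSize? P? r e)) ≡
           ∑ (allFin N) (λ v → 𝟙 (P? v)) C r
#subsets {zero}  P? zero    = refl
#subsets {zero}  P? (suc r) = refl
#subsets {suc N} {P} P? r   = begin
  ∑ (allSubsets (suc N)) count
    ≡⟨ ∑-++ (map (outside ∷_) (allSubsets N)) _ count ⟩
  ∑ (map (outside ∷_) (allSubsets N)) count + ∑ (map (inside ∷_) (allSubsets N)) count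
    ≡⟨ cong₂ _+_ (∑-map (outside ∷_) (allSubsets N) count)
                 (∑-map (inside ∷_) (allSubsets N) count) ⟩
  ∑ (allSubsets N) (count ∘ (outside ∷_)) + ∑ (allSubsets N) (count ∘ (inside ∷_))
    ≡⟨ cong (_+ ∑ (allSubsets N) (count ∘ (inside ∷_))) (∑-cong (allSubsets N) without) ⟩
  ∑ (allSubsets N) (λ e → 𝟙 (isSubsetOfSize? (P? ∘ suc) r e)) +
  ∑ (allSubsets N) (count ∘ (inside ∷_))
    ≡⟨ cong (_+ ∑ (allSubsets N) (count ∘ (inside ∷_))) (#subsets (P? ∘ suc) r) ⟩
  c C r + ∑ (allSubsets N) (count ∘ (inside ∷_))
    ≡⟨ total r (P? zero) ⟩
  (𝟙 (P? zero) + c) C r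
    ≡⟨ cong (_C r) (∑-allFin-suc (λ v → 𝟙 (P? v))) ⟨
  ∑ (allFin (suc N)) (λ v → 𝟙 (P? v)) C r ∎
  where
  open ≡-Reasoning
  count : Subset (suc N) → ℕ
  count e = 𝟙 (isSubsetOfSize? P? r e)

  c : ℕ
  c = ∑ (allFin N) (λ v → 𝟙 (P? (suc v)))

  without : ∀ e → count (outside ∷ e) ≡ 𝟙 (isSubsetOfSize? (P? ∘ suc) r e)
  without e = 𝟙-cong
    (λ (size , ⊆P) → size , λ v v∈e → ⊆P (suc v) (there v∈e))
    (λ (size , ⊆P) → size , λ { (suc v) (there v∈e) → ⊆P v v∈e })
    (isSubsetOfSize? P? r (outside ∷ e)) (isSubsetOfSize? (P? ∘ suc) r e)

  total : ∀ r (p? : Dec (P zero)) →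
          c C r + ∑ (allSubsets N) (λ e → 𝟙 (isSubsetOfSize? P? r (inside ∷ e))) ≡ (𝟙 p? + c) C r
  total zero p? = trans
    (cong₂ _+_ (nC0≡1 c) (∑-zero (allSubsets N)
      (λ e → 𝟙-no (λ ()) (isSubsetOfSize? P? 0 (inside ∷ e)))))
    (sym (nC0≡1 (𝟙 p? + c)))
  total (suc r) (no ¬p) = trans
    (cong (c C suc r +_) (∑-zero (allSubsets N)
      (λ e → 𝟙-no (λ (_ , ⊆P) → ¬p (⊆P zero here)) (isSubsetOfSize? P? (suc r) (inside ∷ e)))))
    (+-identityʳ (c C suc r))
  total (suc r) (yes p) = begin
    c C suc r + ∑ (allSubsets N) (λ e → 𝟙 (isSubsetOfSize? P? (suc r) (inside ∷ e)))
      ≡⟨ cong (c C suc r +_) (trans (∑-cong (allSubsets N) with-zero) (#subsets (P? ∘ suc) r)) ⟩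
    c C suc r + c C r  ≡⟨ +-comm (c C suc r) (c C r) ⟩
    c C r + c C suc r  ≡⟨ pascal c r ⟨
    suc c C suc r      ∎
    where
    with-zero : ∀ e → 𝟙 (isSubsetOfSize? P? (suc r) (inside ∷ e)) ≡
                      𝟙 (isSubsetOfSize? (P? ∘ suc) r e)
    with-zero e = 𝟙-cong
      (λ (size , ⊆P) → suc-injective size , λ v v∈e → ⊆P (suc v) (there v∈e))
      (λ (size , ⊆P) → cong suc size , λ { zero _ → p ; (suc v) (there v∈e) → ⊆P v v∈e })
      (isSubsetOfSize? P? (suc r) (inside ∷ e)) (isSubsetOfSize? (P? ∘ suc) r e)

-- Number of monochromatic edges

∣e∣>0⇒nonempty : ∀ {N} (e : Subset N) → 0 < ∣ e ∣ → ∃[ v ] v ∈ e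
∣e∣>0⇒nonempty (inside  ∷ e) _     = zero , here
∣e∣>0⇒nonempty (outside ∷ e) 0<∣e∣ = Product.map suc there (∣e∣>0⇒nonempty e 0<∣e∣)

module _ (k n : ℕ) (χ : Vertex k n → Color) where

  private
    ClassOfColor : Fin k → Color → Vertex k n → Set
    ClassOfColor i c v = class k n v ≡ i × χ v ≡ c

    classOfColor? : ∀ i c → Decidable (ClassOfColor i c)
    classOfColor? i c v = (class k n v Fin.≟ i) ×-dec (χ v ≟ᶜ c)

  #colored≡∑ : ∀ i c → #colored k n χ i c ≡ ∑ (allFin (k * n)) (λ v → 𝟙 (classOfColor? i c v))
  #colored≡∑ i c = length-filter≡∑ (classOfColor? i c) (allFin (k * n))

  -- Vertices are indexed by class and position. For a fixed position only the class i contributes,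
  -- so the sum over classes collapses.
  #colored-block : ∀ i c → #colored k n χ i c ≡ ∑ (allFin n) (λ j → 𝟙 (χ (combine i j) ≟ᶜ c))
  #colored-block i c = begin
    #colored k n χ i c
      ≡⟨ #colored≡∑ i c ⟩
    ∑ (allFin (k * n)) (λ v → 𝟙 (classOfColor? i c v))
      ≡⟨ ∑-combine k n _ ⟩
    ∑ (allFin k) (λ i′ → ∑ (allFin n) (λ j → 𝟙 (classOfColor? i c (combine i′ j))))
      ≡⟨ ∑-comm (allFin k) (allFin n) _ ⟩
    ∑ (allFin n) (λ j → ∑ (allFin k) (λ i′ → 𝟙 (classOfColor? i c (combine i′ j))))
      ≡⟨ ∑-cong (allFin n) (λ j → sym (𝟙-∃! {Q = λ i′ → ClassOfColor i c (combine i′ j)}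
           (λ q → i , class-combine i j , q)
           (λ i′ (i′≡i , q) → subst (λ z → χ (combine z j) ≡ c)
             (trans (sym (class-combine i′ j)) i′≡i) q)
           (λ i₁ i₂ (p₁ , _) (p₂ , _) →
             trans (sym (class-combine i₁ j)) (trans p₁ (trans (sym p₂) (class-combine i₂ j))))
           (χ (combine i j) ≟ᶜ c) (λ i′ → classOfColor? i c (combine i′ j)))) ⟩
    ∑ (allFin n) (λ j → 𝟙 (χ (combine i j) ≟ᶜ c)) ∎
    where
    open ≡-Reasoning
    class-combine : ∀ i j → class k n (combine i j) ≡ i
    class-combine i j = cong proj₁ (remQuot-combine i j)

  ∑-#colored : ∀ c → ∑ (allFin (k * n)) (λ v → 𝟙 (χ v ≟ᶜ c)) ≡
                     ∑ (allFin k) (λ i → #colored k n χ i c)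
  ∑-#colored c = begin
    ∑ (allFin (k * n)) (λ v → 𝟙 (χ v ≟ᶜ c))
      ≡⟨ ∑-cong (allFin (k * n)) (λ v → 𝟙-∃! {Q = λ i → ClassOfColor i c v}
           (λ q → class k n v , refl , q) (λ _ → proj₂)
           (λ _ _ (p₁ , _) (p₂ , _) → trans (sym p₁) p₂) (χ v ≟ᶜ c) (λ i → classOfColor? i c v)) ⟩
    ∑ (allFin (k * n)) (λ v → ∑ (allFin k) (λ i → 𝟙 (classOfColor? i c v)))
      ≡⟨ ∑-comm (allFin (k * n)) (allFin k) _ ⟩
    ∑ (allFin k) (λ i → ∑ (allFin (k * n)) (λ v → 𝟙 (classOfColor? i c v)))
      ≡⟨ ∑-cong (allFin k) (λ i → #colored≡∑ i c) ⟨
    ∑ (allFin k) (λ i → #colored k n χ i c) ∎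
    where open ≡-Reasoning

  #red+#blue : ∀ i → #colored k n χ i red + #colored k n χ i blue ≡ n
  #red+#blue i = begin
    #colored k n χ i red + #colored k n χ i blue
      ≡⟨ cong₂ _+_ (#colored-block i red) (#colored-block i blue) ⟩
    ∑ (allFin n) (λ j → 𝟙 (χ (combine i j) ≟ᶜ red)) +
    ∑ (allFin n) (λ j → 𝟙 (χ (combine i j) ≟ᶜ blue))
      ≡⟨ ∑-+ (allFin n) _ _ ⟨
    ∑ (allFin n) (λ j → 𝟙 (χ (combine i j) ≟ᶜ red) + 𝟙 (χ (combine i j) ≟ᶜ blue))
      ≡⟨ ∑-cong (allFin n) (λ j → one (χ (combine i j))) ⟩
    ∑ (allFin n) (λ _ → 1)
      ≡⟨ ∑-one n ⟩
    n ∎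
    where
    open ≡-Reasoning
    one : ∀ c → 𝟙 (c ≟ᶜ red) + 𝟙 (c ≟ᶜ blue) ≡ 1
    one red  = refl
    one blue = refl

  #colored-constant : ∀ i c → (∀ v → class k n v ≡ i → χ v ≡ c) → #colored k n χ i c ≡ n
  #colored-constant i c χ≡c = begin
    #colored k n χ i c                            ≡⟨ #colored-block i c ⟩
    ∑ (allFin n) (λ j → 𝟙 (χ (combine i j) ≟ᶜ c))  ≡⟨ ∑-cong (allFin n) (λ j →
      𝟙-yes (χ≡c (combine i j) (cong proj₁ (remQuot-combine i j))) (χ (combine i j) ≟ᶜ c)) ⟩
    ∑ (allFin n) (λ _ → 1)                        ≡⟨ ∑-one n ⟩
    n ∎
    where open ≡-Reasoning

  module _ (r : ℕ) (0<r : 0 < r) where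

    private
      H = completePartite k n r
      open Hypergraph H using (IsEdge; isEdge?)

      inClass : Color → ℕ
      inClass c = ∑ (allFin k) (λ i → #colored k n χ i c C r)

      edgesOfColor : Color → ℕ
      edgesOfColor c = ∑ (allSubsets (k * n)) (λ e → 𝟙 (isEdge? e ×-dec hasColor? H χ c e))

      nonempty : ∀ {e : Subset (k * n)} → ∣ e ∣ ≡ r → ∃[ v ] v ∈ e
      nonempty {e} size = ∣e∣>0⇒nonempty e (subst (0 <_) (sym size) 0<r)

      -- As r > 0, an edge has a vertex and cannot be both red and blue.
      #monochromatic≡ : #monochromatic H χ ≡ edgesOfColor red + edgesOfColor blue
      #monochromatic≡ = begin
        #monochromatic H χ
          ≡⟨ length-filter≡∑ (λ e → isEdge? e ×-dec isMonochromatic? H χ e) (allSubsets (k * n)) ⟩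
        ∑ (allSubsets (k * n)) (λ e → 𝟙 (isEdge? e ×-dec isMonochromatic? H χ e))
          ≡⟨ ∑-cong (allSubsets (k * n)) (λ e → 𝟙-⊎
               (λ { (p , red , q) → inj₁ (p , q) ; (p , blue , q) → inj₂ (p , q) })
               (λ (p , q) → p , red , q) (λ (p , q) → p , blue , q)
               (λ ((size , _) , isRed) (_ , isBlue) → bichromatic isRed isBlue (nonempty size))
               (isEdge? e ×-dec isMonochromatic? H χ e)
               (isEdge? e ×-dec hasColor? H χ red e) (isEdge? e ×-dec hasColor? H χ blue e)) ⟩
        ∑ (allSubsets (k * n)) (λ e → 𝟙 (isEdge? e ×-dec hasColor? H χ red e)
                                    + 𝟙 (isEdge? e ×-dec hasColor? H χ blue e))
          ≡⟨ ∑-+ (allSubsets (k * n)) _ _ ⟩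
        edgesOfColor red + edgesOfColor blue ∎
        where
        open ≡-Reasoning
        bichromatic : ∀ {e : Subset (k * n)} → HasColor H χ red e → HasColor H χ blue e →
                      ¬ (∃[ v ] v ∈ e)
        bichromatic isRed isBlue (v , v∈e) with trans (sym (isRed v v∈e)) (isBlue v v∈e)
        ... | ()

      -- An r-set of color c is either an edge or contained in a class. That class is unique because
      -- the set is nonempty.
      edgesOfColor+inClass : ∀ c → edgesOfColor c + inClass c ≡
                                   ∑ (allFin k) (λ i → #colored k n χ i c) C r
      edgesOfColor+inClass c = sym (begin
        ∑ (allFin k) (λ i → #colored k n χ i c) C r
          ≡⟨ cong (_C r) (∑-#colored c) ⟨
        ∑ (allFin (k * n)) (λ v → 𝟙 (χ v ≟ᶜ c)) C r
          ≡⟨ #subsets (λ v → χ v ≟ᶜ c) r ⟨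
        ∑ (allSubsets (k * n)) (λ e → 𝟙 (isSubsetOfSize? (λ v → χ v ≟ᶜ c) r e))
          ≡⟨ ∑-cong (allSubsets (k * n)) (λ e →
               trans (edge-or-in-class e) (cong (𝟙 (edge? e) +_) (which-class e))) ⟩
        ∑ (allSubsets (k * n)) (λ e → 𝟙 (edge? e) + ∑ (allFin k) (λ i → indicator i e))
          ≡⟨ ∑-+ (allSubsets (k * n)) _ _ ⟩
        edgesOfColor c + ∑ (allSubsets (k * n)) (λ e → ∑ (allFin k) (λ i → indicator i e))
          ≡⟨ cong (edgesOfColor c +_) (∑-comm (allSubsets (k * n)) (allFin k) _) ⟩
        edgesOfColor c + ∑ (allFin k) (λ i → ∑ (allSubsets (k * n)) (λ e → indicator i e))
          ≡⟨ cong (edgesOfColor c +_) (∑-cong (allFin k) (λ i →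
               trans (#subsets (classOfColor? i c) r) (cong (_C r) (sym (#colored≡∑ i c))))) ⟩
        edgesOfColor c + inClass c ∎)
        where
        open ≡-Reasoning
        indicator : Fin k → Subset (k * n) → ℕ
        indicator i e = 𝟙 (isSubsetOfSize? (classOfColor? i c) r e)

        edge? : Decidable (λ e → IsEdge e × HasColor H χ c e)
        edge? e = isEdge? e ×-dec hasColor? H χ c e

        inClass? : Decidable (λ e → (∣ e ∣ ≡ r × HasColor H χ c e) × InSingleClass k n e)
        inClass? e = isSubsetOfSize? (λ v → χ v ≟ᶜ c) r e ×-dec inSingleClass? k n e

        edge-or-in-class : ∀ e → 𝟙 (isSubsetOfSize? (λ v → χ v ≟ᶜ c) r e) ≡
                                 𝟙 (edge? e) + 𝟙 (inClass? e)
        edge-or-in-class e = 𝟙-⊎ split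
          (λ ((size , _) , q) → size , q) proj₁ (λ ((_ , ¬single) , _) (_ , single) → ¬single single)
          (isSubsetOfSize? (λ v → χ v ≟ᶜ c) r e) (edge? e) (inClass? e)
          where
          split : ∣ e ∣ ≡ r × HasColor H χ c e →
                  (IsEdge e × HasColor H χ c e) ⊎
                  ((∣ e ∣ ≡ r × HasColor H χ c e) × InSingleClass k n e)
          split (size , q) with inSingleClass? k n e
          ... | yes single = inj₂ ((size , q) , single)
          ... | no ¬single = inj₁ ((size , ¬single) , q)

        which-class : ∀ e → 𝟙 (inClass? e) ≡ ∑ (allFin k) (λ i → indicator i e)
        which-class e = 𝟙-∃!
          (λ ((size , q) , i , p) → i , size , λ v v∈e → p v v∈e , q v v∈e)
          (λ i (size , q) → (size , λ v v∈e → proj₂ (q v v∈e)) , i , λ v v∈e → proj₁ (q v v∈e))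
          (λ { i j (size , p) (_ , q) → same-class p q (nonempty size) })
          (inClass? e) (λ i → isSubsetOfSize? (classOfColor? i c) r e)
          where
          same-class : ∀ {i j} → (∀ v → v ∈ e → ClassOfColor i c v) →
                       (∀ v → v ∈ e → ClassOfColor j c v) → ∃[ v ] v ∈ e → i ≡ j
          same-class p q (v , v∈e) = trans (sym (proj₁ (p v v∈e))) (proj₁ (q v v∈e))

    #monochromatic-formula :
      #monochromatic H χ + ∑ (allFin k) (λ i → #colored k n χ i red C r + #colored k n χ i blue C r) ≡
      ∑ (allFin k) (λ i → #colored k n χ i red) C r + ∑ (allFin k) (λ i → #colored k n χ i blue) C r
    #monochromatic-formula = begin
      #monochromatic H χ + ∑ (allFin k) (λ i → #colored k n χ i red C r + #colored k n χ i blue C r)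
        ≡⟨ cong₂ _+_ #monochromatic≡ (∑-+ (allFin k) _ _) ⟩
      edgesOfColor red + edgesOfColor blue + (inClass red + inClass blue)
        ≡⟨ interchange (edgesOfColor red) (edgesOfColor blue) (inClass red) (inClass blue) ⟩
      (edgesOfColor red + inClass red) + (edgesOfColor blue + inClass blue)
        ≡⟨ cong₂ _+_ (edgesOfColor+inClass red) (edgesOfColor+inClass blue) ⟩
      ∑ (allFin k) (λ i → #colored k n χ i red) C r + ∑ (allFin k) (λ i → #colored k n χ i blue) C r ∎
      where
      open ≡-Reasoning
      interchange : ∀ p q s t → (p + q) + (s + t) ≡ (p + s) + (q + t)
      interchange = solve-∀

-- The half split

-- A list permutation acts on positions. The casts are needed because the length of `tabulate f`
-- equals k only propositionally.
tabulate-↭⇒permutation : ∀ {a} {A : Set a} {k} (f g : Fin k → A) → tabulate f ↭ tabulate g →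
                         Σ[ σ ∈ Permutation′ k ] (∀ i → g (σ ⟨$⟩ʳ i) ≡ f i)
tabulate-↭⇒permutation {A = A} {k} f g f↭g = σ , g∘σ≗f
  where
  π = onIndices (↭⇒↭ₛ f↭g)
  f-length = length-tabulate f
  g-length = length-tabulate g

  σ : Permutation′ k
  σ = cast-id (sym f-length) ∘ₚ π ∘ₚ cast-id g-length

  g∘σ≗f : ∀ i → g (σ ⟨$⟩ʳ i) ≡ f i
  g∘σ≗f i = begin
    g (cast g-length πi)
      ≡⟨ lookup-tabulate g (cast g-length πi) ⟨
    lookup (tabulate g) (cast (sym g-length) (cast g-length πi))
      ≡⟨ cong (lookup (tabulate g)) (cast-involutive (sym g-length) g-length πi) ⟩
    lookup (tabulate g) πi
      ≡⟨ onIndices-lookup (setoid A) (↭⇒↭ₛ f↭g) (cast (sym f-length) i) ⟨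
    lookup (tabulate f) (cast (sym f-length) i)
      ≡⟨ lookup-tabulate f i ⟩
    f i ∎
    where
    open ≡-Reasoning
    πi = π ⟨$⟩ʳ cast (sym f-length) i

tabulate-constant : ∀ {a} {A : Set a} l (f : Fin l → A) {x} → (∀ i → f i ≡ x) →
                    tabulate f ≡ replicate l x
tabulate-constant zero    f f≡x = refl
tabulate-constant (suc l) f f≡x = cong₂ _∷_ (f≡x zero) (tabulate-constant l (f ∘ suc) (f≡x ∘ suc))

tabulate-constant-++ : ∀ {a} {A : Set a} m {l} (f : Fin (m + l) → A) {x} →
                       (∀ i → toℕ i < m → f i ≡ x) →
                       tabulate f ≡ replicate m x ++ tabulate (f ∘ (m ↑ʳ_))
tabulate-constant-++ zero    f f≡x = refl
tabulate-constant-++ (suc m) f f≡x = cong₂ _∷_ (f≡x zero z<s)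
  (tabulate-constant-++ m (f ∘ suc) (λ i i<m → f≡x (suc i) (s<s i<m)))

-- The odd case has the form `m + suc m` so that `m ↑ʳ zero` is the middle class.
even-or-odd : ∀ k → ∃[ m ] (k ≡ m + m ⊎ k ≡ m + suc m)
even-or-odd zero    = 0 , inj₁ refl
even-or-odd (suc k) with even-or-odd k
... | m , inj₁ refl = m , inj₂ (sym (+-suc m m))
... | m , inj₂ refl = suc m , inj₁ refl

⌊m+1+m/2⌋≡m : ∀ m → ⌊ m + suc m /2⌋ ≡ m
⌊m+1+m/2⌋≡m m = trans (cong ⌊_/2⌋ (+-suc m m)) (sym (n≡⌈n+n/2⌉ m))

∣⌊n/2⌋-⌈n/2⌉∣≤1 : ∀ n → ∣ ⌊ n /2⌋ - ⌈ n /2⌉ ∣ ≤ 1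
∣⌊n/2⌋-⌈n/2⌉∣≤1 zero          = z≤n
∣⌊n/2⌋-⌈n/2⌉∣≤1 (suc zero)    = ≤-refl
∣⌊n/2⌋-⌈n/2⌉∣≤1 (suc (suc n)) = ∣⌊n/2⌋-⌈n/2⌉∣≤1 n

∑-below : ∀ {n h} → h ≤ n → ∑ (allFin n) (λ j → 𝟙 (toℕ j <? h)) ≡ h
∑-below {n}     {zero}  _         = ∑-zero (allFin n) (λ j → 𝟙-no (λ ()) (toℕ j <? 0))
∑-below {suc n} {suc h} (s≤s h≤n) = trans (∑-allFin-suc {n} (λ j → 𝟙 (toℕ j <? suc h)))
  (cong suc (trans (∑-cong (allFin n) (λ j → 𝟙-cong s<s⁻¹ s<s (suc (toℕ j) <? suc h) (toℕ j <? h)))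
                   (∑-below h≤n)))

-- Stated for arbitrary decisions, so that properties of `halfSplit` follow by matching on them. The
-- third decision settles the middle class.
chooseColor : ∀ {P Q S : Set} → Dec P → Dec Q → Dec S → Color
chooseColor (yes _) _       _       = red
chooseColor (no _)  (yes _) _       = blue
chooseColor (no _)  (no _)  (yes _) = red
chooseColor (no _)  (no _)  (no _)  = blue

module _ (k n : ℕ) where

  halfSplit : Vertex k n → Color
  halfSplit v = chooseColor (toℕ (class k n v) <? ⌊ k /2⌋) (k ∸ ⌊ k /2⌋ ≤? toℕ (class k n v))
                            (toℕ (remainder {k} n v) <? ⌊ n /2⌋)

  halfSplit-isHalfSplit : IsHalfSplit k n halfSplit
  halfSplit-isHalfSplit = record
    { first  = λ v → choose-red
    ; last   = λ v p → choose-blue (≤⇒≯ (≤-trans ⌊k/2⌋≤k∸⌊k/2⌋ p)) p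
    ; middle = middle
    }
    where
    choose-red : ∀ {P Q S : Set} {p? : Dec P} {q? : Dec Q} {s? : Dec S} →
                 P → chooseColor p? q? s? ≡ red
    choose-red {p? = yes _} _ = refl
    choose-red {p? = no ¬p} p = contradiction p ¬p

    choose-blue : ∀ {P Q S : Set} {p? : Dec P} {q? : Dec Q} {s? : Dec S} →
                  ¬ P → Q → chooseColor p? q? s? ≡ blue
    choose-blue {p? = yes p}              ¬p _ = contradiction p ¬p
    choose-blue {p? = no _} {q? = yes _}  _  _ = refl
    choose-blue {p? = no _} {q? = no ¬q}  _  q = contradiction q ¬q

    choose-middle : ∀ {P Q S : Set} (p? : Dec P) (q? : Dec Q) (s? : Dec S) → ¬ P → ¬ Q →
                    𝟙 (chooseColor p? q? s? ≟ᶜ red) ≡ 𝟙 s?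
    choose-middle (yes p) _       _       ¬p _  = contradiction p ¬p
    choose-middle (no _)  (yes q) _       _  ¬q = contradiction q ¬q
    choose-middle (no _)  (no _)  (yes _) _  _  = refl
    choose-middle (no _)  (no _)  (no _)  _  _  = refl

    ⌊k/2⌋≤k∸⌊k/2⌋ : ⌊ k /2⌋ ≤ k ∸ ⌊ k /2⌋
    ⌊k/2⌋≤k∸⌊k/2⌋ = m+n≤o⇒m≤o∸n ⌊ k /2⌋
      (≤-trans (+-monoʳ-≤ ⌊ k /2⌋ (⌊n/2⌋≤⌈n/2⌉ k)) (≤-reflexive (⌊n/2⌋+⌈n/2⌉≡n k)))

    middle : ∀ i → ⌊ k /2⌋ ≤ toℕ i → toℕ i < k ∸ ⌊ k /2⌋ →
             ∣ #colored k n halfSplit i red - #colored k n halfSplit i blue ∣ ≤ 1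
    middle i ⌊k/2⌋≤i i<k∸⌊k/2⌋ =
      subst₂ (λ u v → ∣ u - v ∣ ≤ 1) (sym #red) (sym #blue) (∣⌊n/2⌋-⌈n/2⌉∣≤1 n)
      where
      #red : #colored k n halfSplit i red ≡ ⌊ n /2⌋
      #red = begin
        #colored k n halfSplit i red
          ≡⟨ #colored-block k n halfSplit i red ⟩
        ∑ (allFin n) (λ j → 𝟙 (halfSplit (combine i j) ≟ᶜ red))
          ≡⟨ ∑-cong (allFin n) (λ j → trans
               (choose-middle (toℕ (class k n (combine i j)) <? ⌊ k /2⌋)
                 (k ∸ ⌊ k /2⌋ ≤? toℕ (class k n (combine i j)))
                 (toℕ (remainder {k} n (combine i j)) <? ⌊ n /2⌋)
                 (≤⇒≯ (subst (λ z → ⌊ k /2⌋ ≤ toℕ z) (sym (cong proj₁ (remQuot-combine i j))) ⌊k/2⌋≤i))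
                 (<⇒≱ (subst (λ z → toℕ z < k ∸ ⌊ k /2⌋)
                   (sym (cong proj₁ (remQuot-combine i j))) i<k∸⌊k/2⌋)))
               (cong (λ z → 𝟙 (toℕ (proj₂ z) <? ⌊ n /2⌋)) (remQuot-combine i j))) ⟩
        ∑ (allFin n) (λ j → 𝟙 (toℕ j <? ⌊ n /2⌋))
          ≡⟨ ∑-below (⌊n/2⌋≤n n) ⟩
        ⌊ n /2⌋ ∎
        where open ≡-Reasoning
      #blue : #colored k n halfSplit i blue ≡ ⌈ n /2⌉
      #blue = +-cancelˡ-≡ ⌊ n /2⌋ _ _
        (trans (cong (_+ #colored k n halfSplit i blue) (sym #red))
          (trans (#red+#blue k n halfSplit i) (sym (⌊n/2⌋+⌈n/2⌉≡n n))))

-- Minimality and uniqueness of the half split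

module _ (k n r : ℕ) (r+3≤n : 3 + r ≤ n) where

  -- Strict convexity starts at 2 + r, and `r+3≤n` unfolds to 2 + r < n.
  open Profiles (_C (3 + r)) (C-convex (2 + r)) r+3≤n (C-strictlyConvex (1 + r))

  private
    H = completePartite k n (3 + r)

    counts : (Vertex k n → Color) → Fin k → ℕ × ℕ
    counts χ i = #colored k n χ i red , #colored k n χ i blue

    profile : (Vertex k n → Color) → Profile
    profile χ = tabulate (counts χ)

    #monochromatic+value : ∀ χ → #monochromatic H χ + value (profile χ) ≡ spread (profile χ)
    #monochromatic+value χ = trans
      (cong (#monochromatic H χ +_) (∑-tabulate (counts χ) pairValue))
      (trans (#monochromatic-formula k n χ (3 + r) z<s)
        (sym (cong₂ (λ u v → u C (3 + r) + v C (3 + r))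
          (∑-tabulate (counts χ) proj₁) (∑-tabulate (counts χ) proj₂))))

    -- Both sides of a comparison of profiles become a number of monochromatic edges plus the same
    -- sum of two values, which can then be cancelled.
    expand : ∀ χ χ′ → spread (profile χ) + value (profile χ′) ≡
                      #monochromatic H χ + (value (profile χ) + value (profile χ′))
    expand χ χ′ = trans (cong (_+ value (profile χ′)) (sym (#monochromatic+value χ)))
                        (+-assoc (#monochromatic H χ) _ _)

    expand′ : ∀ χ χ′ → spread (profile χ′) + value (profile χ) ≡
                       #monochromatic H χ′ + (value (profile χ) + value (profile χ′))
    expand′ χ χ′ = trans (expand χ′ χ)
      (cong (#monochromatic H χ′ +_) (+-comm (value (profile χ′)) (value (profile χ))))

    ⊑⇒≤ : ∀ χ χ′ → profile χ ⊑ profile χ′ → #monochromatic H χ ≤ #monochromatic H χ′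
    ⊑⇒≤ χ χ′ χ⊑χ′ = +-cancelʳ-≤ (value (profile χ) + value (profile χ′)) _ _
      (subst₂ _≤_ (expand χ χ′) (expand′ χ χ′) (⊑-weaken {profile χ} {profile χ′} χ⊑χ′))

    swapColors : Color ↔ Color
    swapColors = mk↔ₛ′ other other involutive involutive
      where
      other : Color → Color
      other red  = blue
      other blue = red
      involutive : ∀ c → other (other c) ≡ c
      involutive red  = refl
      involutive blue = refl

    -- A strict comparison contradicts minimality. The other two alternatives are reorderings of the
    -- class counts, with the colors kept or swapped.
    ⊑-minimizing⇒same : ∀ χ χ′ → profile χ ⊑ profile χ′ → IsMinimizing H χ′ →
                        SameUpToPermutation k n χ χ′
    ⊑-minimizing⇒same χ χ′ (inj₁ better) minimizing = contradiction (minimizing χ)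
      (<⇒≱ (+-cancelʳ-< (value (profile χ) + value (profile χ′)) _ _
        (subst₂ _<_ (expand χ χ′) (expand′ χ χ′) better)))
    ⊑-minimizing⇒same χ χ′ (inj₂ (inj₁ p)) _ with tabulate-↭⇒permutation (counts χ) (counts χ′) p
    ... | σ , eq = σ , ↔-id Color , λ { i red → cong proj₁ (eq i) ; i blue → cong proj₂ (eq i) }
    ⊑-minimizing⇒same χ χ′ (inj₂ (inj₂ p)) _
      with tabulate-↭⇒permutation (Product.swap ∘ counts χ) (counts χ′)
             (↭-trans (↭-reflexive (sym (map-tabulate (counts χ) Product.swap))) p)
    ... | σ , eq = σ , swapColors , λ { i red → cong proj₂ (eq i) ; i blue → cong proj₁ (eq i) }

    red-class : ∀ χ i → (∀ v → class k n v ≡ i → χ v ≡ red) → counts χ i ≡ (n , 0)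
    red-class χ i isRed = cong₂ _,_ #red≡n (+-cancelˡ-≡ n _ _ (begin
      n + #colored k n χ i blue                     ≡⟨ cong (_+ #colored k n χ i blue) #red≡n ⟨
      #colored k n χ i red + #colored k n χ i blue  ≡⟨ #red+#blue k n χ i ⟩
      n                                             ≡⟨ +-identityʳ n ⟨
      n + 0                                         ∎))
      where
      open ≡-Reasoning
      #red≡n = #colored-constant k n χ i red isRed

    blue-class : ∀ χ i → (∀ v → class k n v ≡ i → χ v ≡ blue) → counts χ i ≡ (0 , n)
    blue-class χ i isBlue = cong₂ _,_ (+-cancelʳ-≡ n _ _ (begin
      #colored k n χ i red + n                      ≡⟨ cong (#colored k n χ i red +_) #blue≡n ⟨
      #colored k n χ i red + #colored k n χ i blue  ≡⟨ #red+#blue k n χ i ⟩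
      n                                             ∎)) #blue≡n
      where
      open ≡-Reasoning
      #blue≡n = #colored-constant k n χ i blue isBlue

  module _ (2≤k : 2 ≤ k) (χ : Vertex k n → Color) (halved : IsHalfSplit k n χ) where

    open IsHalfSplit halved

    private
      first-class : ∀ i → toℕ i < ⌊ k /2⌋ → counts χ i ≡ (n , 0)
      first-class i i<⌊k/2⌋ = red-class χ i (λ { v refl → first v i<⌊k/2⌋ })

      last-class : ∀ i → k ∸ ⌊ k /2⌋ ≤ toℕ i → counts χ i ≡ (0 , n)
      last-class i k∸⌊k/2⌋≤i = blue-class χ i (λ { v refl → last v k∸⌊k/2⌋≤i })

    -- The definition of a half split fixes its profile up to order, except for the counts in the
    -- middle class, which are known to be nearly equal. As k ≥ 2, there is a full class of each
    -- color.
    halfSplit-⊑ : ∀ χ′ → profile χ ⊑ profile χ′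
    halfSplit-⊑ χ′ with even-or-odd k
    ... | zero  , inj₁ refl = contradiction 2≤k λ ()
    ... | zero  , inj₂ refl = contradiction 2≤k λ { (s≤s ()) }
    ... | m@(suc _) , inj₁ refl = ⊑-canonical⇒⊑ {profile χ}
      (λ {s} {t} {q} {q′} size len → ⊑-respˡ-↭ {L = (s , t) ∷ extremes q q′}
        (↭-reflexive (sym profile≡))
        (even-optimal m {s} {t} {q} {q′} z<s size len))
      (profile χ′) (tabulate⁺ {f = counts χ′} (#red+#blue k n χ′)) (length-tabulate (counts χ′))
      where
      profile≡ : profile χ ≡ extremes m m
      profile≡ = trans
        (tabulate-constant-++ m (counts χ) (λ i i<m →
          first-class i (subst (toℕ i <_) (n≡⌊n+n/2⌋ m) i<m)))
        (cong (replicate m (n , 0) ++_) (tabulate-constant m _ (λ i → last-class (m ↑ʳ i)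
          (subst₂ _≤_ (trans (sym (m+n∸n≡m m m)) (cong (m + m ∸_) (n≡⌊n+n/2⌋ m)))
                      (sym (toℕ-↑ʳ m i)) (m≤m+n m (toℕ i))))))
    ... | m@(suc _) , inj₂ refl = ⊑-canonical⇒⊑ {profile χ}
      (λ {s} {t} {q} {q′} size len → ⊑-respˡ-↭ {L = (s , t) ∷ extremes q q′} (↭-sym profile↭)
        (odd-optimal (λ M → crossing M (3 + r)) (λ M → crossing+C M (3 + r))
          -- Strict convexity of `crossing` asks for r < M, which follows from 3 + r ≤ n ≤ M.
          (λ M n≤M → crossing-strictlyConvex M r (≤-trans (m≤n+m (suc r) 2) (≤-trans r+3≤n n≤M)))
          (≤-trans (s≤s (s≤s z≤n)) r+3≤n) z<s (#red+#blue k n χ mid) near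
          {s} {t} {q} {q′} size (suc-injective (trans len (+-suc m m)))))
      (profile χ′) (tabulate⁺ {f = counts χ′} (#red+#blue k n χ′)) (length-tabulate (counts χ′))
      where
      mid : Fin k
      mid = m ↑ʳ zero

      k∸⌊k/2⌋≡ : k ∸ ⌊ k /2⌋ ≡ suc m
      k∸⌊k/2⌋≡ = trans (cong (k ∸_) (⌊m+1+m/2⌋≡m m)) (m+n∸m≡n m (suc m))

      near : ∣ #colored k n χ mid red - #colored k n χ mid blue ∣ ≤ 1
      near = middle mid
        (≤-reflexive (trans (⌊m+1+m/2⌋≡m m) (sym mid≡m)))
        (subst₂ _<_ (sym mid≡m) (sym k∸⌊k/2⌋≡) ≤-refl)
        where
        mid≡m : toℕ mid ≡ m
        mid≡m = trans (toℕ-↑ʳ m zero) (+-identityʳ m)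

      profile↭ : profile χ ↭ counts χ mid ∷ extremes m m
      profile↭ = ↭-trans (↭-reflexive (trans
        (tabulate-constant-++ m (counts χ) (λ i i<m →
          first-class i (subst (toℕ i <_) (sym (⌊m+1+m/2⌋≡m m)) i<m)))
        (cong (λ L → replicate m (n , 0) ++ counts χ mid ∷ L)
          (tabulate-constant m _ (λ i → last-class (m ↑ʳ suc i)
            (subst₂ _≤_ (sym k∸⌊k/2⌋≡) (trans (sym (+-suc m (toℕ i))) (sym (toℕ-↑ʳ m (suc i))))
              (s≤s (m≤m+n m (toℕ i)))))))))
        (shift (counts χ mid) (replicate m (n , 0)) (replicate m (0 , n)))

    halfSplit-minimizing : IsMinimizing H χ
    halfSplit-minimizing χ′ = ⊑⇒≤ χ χ′ (halfSplit-⊑ χ′)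

    halfSplit-unique : ∀ χ′ → IsMinimizing H χ′ → SameUpToPermutation k n χ χ′
    halfSplit-unique χ′ = ⊑-minimizing⇒same χ χ′ (halfSplit-⊑ χ′)

theorem2 : ∀ (n r k : ℕ) → 3 ≤ r → r ≤ n → 2 ≤ k →
    let H = completePartite k n r in
    (∃[ χ ] IsHalfSplit k n χ) ×
    (∀ χ → IsHalfSplit k n χ →
    IsMinimizing H χ ×
    (∀ χ′ → IsMinimizing H χ′ → SameUpToPermutation k n χ χ′))
theorem2 n (suc (suc (suc r))) k (s≤s (s≤s (s≤s z≤n))) r≤n 2≤k =
  (halfSplit k n , halfSplit-isHalfSplit k n) ,
  λ χ halved → halfSplit-minimizing k n r r≤n 2≤k χ halved , halfSplit-unique k n r r≤n 2≤k χ halved
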